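{- Let $\Gamma$ be a vertex- and arc-transitive two-ended digraph, and let $G=\mathrm{Aut}(\Gamma)$. Then $G$ contains a normal subgroup $N$ having finite orbits on $V\Gamma$ such that either: (i) $\Gamma/N\cong\mathbb Z$ and $G/N\cong D_\infty$; or (ii) $\Gamma/N\cong\vec{\mathbb Z}$ and $G/N\cong\mathbb Z$. In particular, $\Gamma$ has Property Z in case (ii) but not in case (i). Moreover, if $\Gamma$ is $2$-arc-transitive, then (ii) holds. In case (i) $G$ acts transitively on the ends of $\Gamma$, but in case (ii) $G$ acts trivially on the ends of $\Gamma$.
   Context: A digraph $\Gamma=(V\Gamma,E\Gamma)$ has vertex set $V\Gamma$ and arc set $E\Gamma\subseteq V\Gamma\times V\Gamma$; both $(v,w)$ and $(w,v)$ may be arcs. It is connected if its underlying undirected graph is connected. $\Gamma$ is vertex-transitive (arc-transitive, 2-arc-transitive) if $\mathrm{Aut}(\Gamma)$ is transitive on vertices (arcs, 2-arcs), where a 2-arc is a sequence $v_0,v_1,v_2$ of vertices with $(v_0,v_1),(v_1,v_2)\in E\Gamma$. A ray is a one-way infinite path (in the underlying undirected graph) with distinct vertices. The ends of a digraph are the equivalence classes of rays, where two rays are equivalent if there is an infinite family of pairwise disjoint paths (ignoring directions) each having its initial vertex in one ray and terminal vertex in the other. A digraph is two-ended if it is connected and has exactly two ends. $\mathrm{Aut}(\Gamma)$ acts on the set of ends. The symbol $\mathbb Z$ denotes both the group of integers and the digraph with vertex set $\mathbb Z$ and arcs $(i,i+1)$ and $(i+1,i)$ for all $i\in\mathbb Z$;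 $\vec{\mathbb Z}$ is the digraph with vertex set $\mathbb Z$ and arcs $(i,i+1)$ for all $i\in\mathbb Z$. $D_\infty$ is the infinite dihedral group. For a subgroup $N\le\mathrm{Aut}(\Gamma)$, the quotient digraph $\Gamma/N$ has the $N$-orbits on $V\Gamma$ as vertices, and $(A,B)$ is an arc of $\Gamma/N$ iff there are $v\in A$, $w\in B$ with $(v,w)\in E\Gamma$. A connected digraph $\Gamma$ has Property Z if there is a surjective digraph homomorphism (a map on vertices sending arcs to arcs, preserving direction) $\Gamma\to\vec{\mathbb Z}$. -}

module Defs where

open import Algebra.Bundles using (AbelianGroup; Group)
open import Algebra.Morphism.Structures using (module GroupMorphisms)
import Algebra.Properties.Group as GroupProperties
open import Data.Fin.Base using (Fin; zero; suc; inject₁; fromℕ)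
open import Data.Integer.Base as ℤ using (ℤ)
import Data.Integer.Properties as ℤ
open import Data.List.Base using (List)
open import Data.List.Membership.Propositional using (_∈_)
open import Data.Nat.Base as ℕ using (ℕ)
open import Data.Product.Base using (Σ-syntax; ∃-syntax; _×_; _,_; proj₁; proj₂)
open import Data.Sign.Base as Sign using (Sign)
import Data.Sign.Properties as Sign
open import Data.Sum.Base using (_⊎_)
open import Function.Base using (_∘_)
open import Function.Bundles using (_↔_; _⇔_; module Inverse)
open import Function.Construct.Composition using (_↔-∘_)
open import Function.Construct.Identity using (↔-id)
open import Function.Construct.Symmetry using (↔-sym)
open import Function.Definitions using (Injective; Surjective)
open import Level using (0ℓ)
open import Relation.Binary.Bundles using (Setoid)
open import Relation.Binary.Construct.Closure.Equivalence using (EqClosure)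
open import Relation.Binary.Construct.Closure.Symmetric as Sym using (SymClosure)
open import Relation.Binary.Core using (Rel)
open import Relation.Binary.Definitions using (_Respects₂_)
open import Relation.Binary.Morphism.Structures using (IsOrderIsomorphism)
open import Relation.Binary.PropositionalEquality as ≡
  using (_≡_; _≢_; refl; cong; cong₂; subst₂)
open import Relation.Nullary.Negation using (¬_)
open import Relation.Unary using (Pred)

------------------------------------------------------------------------
-- Groups

record Subgroup (G : Group 0ℓ 0ℓ) : Set₁ where
  open Group G
  field
    Member    : Pred Carrier 0ℓ
    resp      : ∀ {g h} → g ≈ h → Member g → Member h
    ε-closed  : Member ε
    ∙-closed  : ∀ {g h} → Member g → Member h → Member (g ∙ h)
    ⁻¹-closed : ∀ {g} → Member g → Member (g ⁻¹)

IsNormal : {G : Group 0ℓ 0ℓ} → Subgroup G → Set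
IsNormal {G} N = ∀ g {n} → Member n → Member (g ∙ n ∙ g ⁻¹)
  where open Group G; open Subgroup N

-- The carrier of G / N is that of G; the equality is
-- "g and h lie in the same left coset of N".
module _ {G : Group 0ℓ 0ℓ} (N : Subgroup G) (normal : IsNormal N) where
  open Group G hiding (refl)
  open Subgroup N
  open GroupProperties G
  open import Relation.Binary.Reasoning.Setoid setoid

  private
    _≈ᴺ_ : Rel Carrier 0ℓ
    g ≈ᴺ h = Member (g ⁻¹ ∙ h)

    ≈⇒≈ᴺ : ∀ {g h} → g ≈ h → g ≈ᴺ h
    ≈⇒≈ᴺ {g} {h} g≈h = resp (begin
      ε         ≈⟨ inverseˡ g ⟨
      g ⁻¹ ∙ g  ≈⟨ ∙-congˡ g≈h ⟩
      g ⁻¹ ∙ h  ∎) ε-closed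

    ≈ᴺ-sym : ∀ {g h} → g ≈ᴺ h → h ≈ᴺ g
    ≈ᴺ-sym {g} {h} p = resp (begin
      (g ⁻¹ ∙ h) ⁻¹     ≈⟨ ⁻¹-anti-homo-∙ (g ⁻¹) h ⟩
      h ⁻¹ ∙ g ⁻¹ ⁻¹    ≈⟨ ∙-congˡ (⁻¹-involutive g) ⟩
      h ⁻¹ ∙ g          ∎) (⁻¹-closed p)

    cancel-middle : ∀ a g b → (a ∙ g) ∙ (g ⁻¹ ∙ b) ≈ a ∙ b
    cancel-middle a g b = begin
      (a ∙ g) ∙ (g ⁻¹ ∙ b)   ≈⟨ assoc a g _ ⟩
      a ∙ (g ∙ (g ⁻¹ ∙ b))   ≈⟨ ∙-congˡ (assoc g (g ⁻¹) b) ⟨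
      a ∙ ((g ∙ g ⁻¹) ∙ b)   ≈⟨ ∙-congˡ (∙-congʳ (inverseʳ g)) ⟩
      a ∙ (ε ∙ b)            ≈⟨ ∙-congˡ (identityˡ b) ⟩
      a ∙ b                  ∎

    ≈ᴺ-trans : ∀ {g h k} → g ≈ᴺ h → h ≈ᴺ k → g ≈ᴺ k
    ≈ᴺ-trans {g} {h} {k} p q =
      resp (cancel-middle (g ⁻¹) h k) (∙-closed p q)

    ∙-congᴺ : ∀ {g g′ h h′} → g ≈ᴺ g′ → h ≈ᴺ h′ → (g ∙ h) ≈ᴺ (g′ ∙ h′)
    ∙-congᴺ {g} {g′} {h} {h′} p q = resp (begin
      (h ⁻¹ ∙ (g ⁻¹ ∙ g′) ∙ h ⁻¹ ⁻¹) ∙ (h ⁻¹ ∙ h′)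
        ≈⟨ ∙-congʳ (∙-congˡ (⁻¹-involutive h)) ⟩
      (h ⁻¹ ∙ (g ⁻¹ ∙ g′) ∙ h) ∙ (h ⁻¹ ∙ h′)
        ≈⟨ cancel-middle _ h h′ ⟩
      h ⁻¹ ∙ (g ⁻¹ ∙ g′) ∙ h′
        ≈⟨ ∙-congʳ (assoc _ _ _) ⟨
      h ⁻¹ ∙ g ⁻¹ ∙ g′ ∙ h′
        ≈⟨ assoc _ _ _ ⟩
      (h ⁻¹ ∙ g ⁻¹) ∙ (g′ ∙ h′)
        ≈⟨ ∙-congʳ (⁻¹-anti-homo-∙ g h) ⟨
      (g ∙ h) ⁻¹ ∙ (g′ ∙ h′)
        ∎) (∙-closed (normal (h ⁻¹) p) q)

    ⁻¹-congᴺ : ∀ {g h} → g ≈ᴺ h → (g ⁻¹) ≈ᴺ (h ⁻¹)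
    ⁻¹-congᴺ {g} {h} p = resp (begin
      h ∙ (h ⁻¹ ∙ g) ∙ h ⁻¹   ≈⟨ ∙-congʳ (assoc h (h ⁻¹) g) ⟨
      h ∙ h ⁻¹ ∙ g ∙ h ⁻¹     ≈⟨ ∙-congʳ (∙-congʳ (inverseʳ h)) ⟩
      ε ∙ g ∙ h ⁻¹            ≈⟨ ∙-congʳ (identityˡ g) ⟩
      g ∙ h ⁻¹                ≈⟨ ∙-congʳ (⁻¹-involutive g) ⟨
      g ⁻¹ ⁻¹ ∙ h ⁻¹          ∎) (normal h (≈ᴺ-sym p))

  quotientGroup : Group 0ℓ 0ℓ
  quotientGroup = record
    { Carrier = Carrier
    ; _≈_     = _≈ᴺ_
    ; _∙_     = _∙_
    ; ε       = ε
    ; _⁻¹     = _⁻¹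
    ; isGroup = record
      { isMonoid = record
        { isSemigroup = record
          { isMagma = record
            { isEquivalence = record
              { refl  = ≈⇒≈ᴺ (Group.refl G)
              ; sym   = ≈ᴺ-sym
              ; trans = ≈ᴺ-trans
              }
            ; ∙-cong = ∙-congᴺ
            }
          ; assoc = λ g h k → ≈⇒≈ᴺ (assoc g h k)
          }
        ; identity = (λ g → ≈⇒≈ᴺ (identityˡ g)) , (λ g → ≈⇒≈ᴺ (identityʳ g))
        }
      ; inverse = (λ g → ≈⇒≈ᴺ (inverseˡ g)) , (λ g → ≈⇒≈ᴺ (inverseʳ g))
      ; ⁻¹-cong = ⁻¹-congᴺ
      }
    }

infix 4 _≅ᴳ_

_≅ᴳ_ : Group 0ℓ 0ℓ → Group 0ℓ 0ℓ → Set
G ≅ᴳ H = ∃[ f ] IsGroupIsomorphism f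
  where open GroupMorphisms (Group.rawGroup G) (Group.rawGroup H)

ℤ-group : Group 0ℓ 0ℓ
ℤ-group = AbelianGroup.group ℤ.+-0-abelianGroup

-- D∞ = ℤ ⋊ {±1}, the sign - acting on ℤ by negation.

infixr 8 _◂_

_◂_ : Sign → ℤ → ℤ
Sign.+ ◂ i = i
Sign.- ◂ i = ℤ.- i

private
  ◂-distrib-+ : ∀ s i j → s ◂ (i ℤ.+ j) ≡ s ◂ i ℤ.+ s ◂ j
  ◂-distrib-+ Sign.+ i j = refl
  ◂-distrib-+ Sign.- i j = ℤ.neg-distrib-+ i j

  ◂-assoc : ∀ s t i → (s Sign.* t) ◂ i ≡ s ◂ t ◂ i
  ◂-assoc Sign.+ t      i = refl
  ◂-assoc Sign.- Sign.+ i = refl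
  ◂-assoc Sign.- Sign.- i = ≡.sym (ℤ.neg-involutive i)

  ◂-zero : ∀ s → s ◂ ℤ.0ℤ ≡ ℤ.0ℤ
  ◂-zero Sign.+ = refl
  ◂-zero Sign.- = refl

D∞ : Group 0ℓ 0ℓ
D∞ = record
  { Carrier = ℤ × Sign
  ; _≈_     = _≡_
  ; _∙_     = _∙_
  ; ε       = ε
  ; _⁻¹     = _⁻¹
  ; isGroup = record
    { isMonoid = record
      { isSemigroup = record
        { isMagma = record
          { isEquivalence = ≡.isEquivalence
          ; ∙-cong        = cong₂ _∙_
          }
        ; assoc = assoc
        }
      ; identity = identityˡ , identityʳ
      }
    ; inverse = inverseˡ , inverseʳ
    ; ⁻¹-cong = cong _⁻¹
    }
  }
  where
  open ≡.≡-Reasoning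

  _∙_ : ℤ × Sign → ℤ × Sign → ℤ × Sign
  (i , s) ∙ (j , t) = i ℤ.+ s ◂ j , s Sign.* t

  ε : ℤ × Sign
  ε = ℤ.0ℤ , Sign.+

  _⁻¹ : ℤ × Sign → ℤ × Sign
  (i , s) ⁻¹ = s ◂ ℤ.- i , s

  assoc : ∀ x y z → (x ∙ y) ∙ z ≡ x ∙ (y ∙ z)
  assoc (i , s) (j , t) (k , u) = cong₂ _,_ (begin
    (i ℤ.+ s ◂ j) ℤ.+ (s Sign.* t) ◂ k  ≡⟨ ℤ.+-assoc i _ _ ⟩
    i ℤ.+ (s ◂ j ℤ.+ (s Sign.* t) ◂ k)  ≡⟨ cong (λ l → i ℤ.+ (s ◂ j ℤ.+ l)) (◂-assoc s t k) ⟩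
    i ℤ.+ (s ◂ j ℤ.+ s ◂ t ◂ k)         ≡⟨ cong (ℤ._+_ i) (◂-distrib-+ s j (t ◂ k)) ⟨
    i ℤ.+ s ◂ (j ℤ.+ t ◂ k)             ∎) (Sign.*-assoc s t u)

  identityˡ : ∀ x → ε ∙ x ≡ x
  identityˡ (i , s) = cong (_, s) (ℤ.+-identityˡ i)

  identityʳ : ∀ x → x ∙ ε ≡ x
  identityʳ (i , s) = cong₂ _,_
    (≡.trans (cong (ℤ._+_ i) (◂-zero s)) (ℤ.+-identityʳ i))
    (Sign.*-identityʳ s)

  inverseˡ : ∀ x → (x ⁻¹) ∙ x ≡ ε
  inverseˡ (i , s) = cong₂ _,_ (begin
    s ◂ ℤ.- i ℤ.+ s ◂ i   ≡⟨ ◂-distrib-+ s (ℤ.- i) i ⟨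
    s ◂ (ℤ.- i ℤ.+ i)     ≡⟨ cong (s ◂_) (ℤ.+-inverseˡ i) ⟩
    s ◂ ℤ.0ℤ              ≡⟨ ◂-zero s ⟩
    ℤ.0ℤ                  ∎) (Sign.s*s≡+ s)

  inverseʳ : ∀ x → x ∙ (x ⁻¹) ≡ ε
  inverseʳ (i , s) = cong₂ _,_ (begin
    i ℤ.+ s ◂ s ◂ ℤ.- i            ≡⟨ cong (ℤ._+_ i) (◂-assoc s s (ℤ.- i)) ⟨
    i ℤ.+ (s Sign.* s) ◂ (ℤ.- i)   ≡⟨ cong (λ t → i ℤ.+ t ◂ (ℤ.- i)) (Sign.s*s≡+ s) ⟩
    i ℤ.+ ℤ.- i                    ≡⟨ ℤ.+-inverseʳ i ⟩
    ℤ.0ℤ                           ∎) (Sign.s*s≡+ s)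

------------------------------------------------------------------------
-- Digraphs

record Digraph : Set₁ where
  infix 4 _⟶_ _─_
  field
    Vertex : Set
    _⟶_    : Rel Vertex 0ℓ

  -- Adjacency in the underlying undirected graph.
  _─_ : Rel Vertex 0ℓ
  _─_ = SymClosure _⟶_

-- A digraph whose vertices are taken up to an equivalence relation.  It is
-- needed because the vertices of Γ / N are orbits.
record SetoidDigraph : Set₁ where
  field
    vertices : Setoid 0ℓ 0ℓ
  open Setoid vertices using (_≈_) renaming (Carrier to Vertex) public
  field
    _⟶_  : Rel Vertex 0ℓ
    resp : _⟶_ Respects₂ _≈_

discrete : Digraph → SetoidDigraph
discrete Γ = record
  { vertices = ≡.setoid Vertex
  ; _⟶_      = _⟶_
  ; resp     = ≡.resp₂ _⟶_
  }
  where open Digraph Γ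

infix 4 _≅ᴰ_

-- IsOrderIsomorphism makes sense for arbitrary relations, not only orders: f
-- is a bijection of setoids that preserves and reflects arcs.
_≅ᴰ_ : SetoidDigraph → SetoidDigraph → Set
Γ ≅ᴰ Δ = ∃[ f ] IsOrderIsomorphism Γ._≈_ Δ._≈_ Γ._⟶_ Δ._⟶_ f
  where
  module Γ = SetoidDigraph Γ
  module Δ = SetoidDigraph Δ

ℤ-digraph : Digraph
ℤ-digraph = record
  { Vertex = ℤ
  ; _⟶_    = λ i j → j ≡ ℤ.suc i ⊎ i ≡ ℤ.suc j
  }

ℤ→-digraph : Digraph
ℤ→-digraph = record
  { Vertex = ℤ
  ; _⟶_    = λ i j → j ≡ ℤ.suc i
  }

Connected : Digraph → Set
Connected Γ = ∀ v w → EqClosure _⟶_ v w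
  where open Digraph Γ

PropertyZ : Digraph → Set
PropertyZ Γ = ∃[ f ] (∀ {v w} → v Γ.⟶ w → f v ℤ→.⟶ f w) × Surjective _≡_ _≡_ f
  where
  module Γ = Digraph Γ
  module ℤ→ = Digraph ℤ→-digraph

------------------------------------------------------------------------
-- Automorphisms

module _ (Γ : Digraph) where
  open Digraph Γ

  record Automorphism : Set where
    field
      perm : Vertex ↔ Vertex
    open Inverse perm public using (to; from; strictlyInverseˡ; strictlyInverseʳ)
    field
      preserves : ∀ {v w} → v ⟶ w → to v ⟶ to w
      reflects  : ∀ {v w} → to v ⟶ to w → v ⟶ w

  open Automorphism

  private
    _∘ᴬ_ : Automorphism → Automorphism → Automorphism
    g ∘ᴬ h = record
      { perm      = perm g ↔-∘ perm h
      ; preserves = preserves g ∘ preserves h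
      ; reflects  = reflects h ∘ reflects g
      }

    idᴬ : Automorphism
    idᴬ = record
      { perm      = ↔-id Vertex
      ; preserves = λ a → a
      ; reflects  = λ a → a
      }

    _⁻¹ᴬ : Automorphism → Automorphism
    g ⁻¹ᴬ = record
      { perm      = ↔-sym (perm g)
      ; preserves = λ {v} {w} a → reflects g
          (subst₂ _⟶_ (≡.sym (strictlyInverseˡ g v)) (≡.sym (strictlyInverseˡ g w)) a)
      ; reflects  = λ {v} {w} a →
          subst₂ _⟶_ (strictlyInverseˡ g v) (strictlyInverseˡ g w) (preserves g a)
      }

  Aut : Group 0ℓ 0ℓ
  Aut = record
    { Carrier = Automorphism
    ; _≈_     = λ g h → ∀ v → to g v ≡ to h v
    ; _∙_     = _∘ᴬ_
    ; ε       = idᴬ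
    ; _⁻¹     = _⁻¹ᴬ
    ; isGroup = record
      { isMonoid = record
        { isSemigroup = record
          { isMagma = record
            { isEquivalence = record
              { refl  = λ _ → refl
              ; sym   = λ p v → ≡.sym (p v)
              ; trans = λ p q v → ≡.trans (p v) (q v)
              }
            ; ∙-cong = λ {g} {g′} {h} {h′} p q v →
                ≡.trans (cong (to g) (q v)) (p (to h′ v))
            }
          ; assoc = λ _ _ _ _ → refl
          }
        ; identity = (λ _ _ → refl) , (λ _ _ → refl)
        }
      ; inverse = strictlyInverseʳ , strictlyInverseˡ
      ; ⁻¹-cong = λ {g} {h} p v → ≡.trans
          (≡.sym (strictlyInverseʳ h (from g v)))
          (cong (from h) (≡.trans (≡.sym (p (from g v))) (strictlyInverseˡ g v)))
      }
    }

  VertexTransitive : Set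
  VertexTransitive = ∀ v w → ∃[ g ] to g v ≡ w

  ArcTransitive : Set
  ArcTransitive = ∀ {v₀ v₁ w₀ w₁} → v₀ ⟶ v₁ → w₀ ⟶ w₁ →
    ∃[ g ] to g v₀ ≡ w₀ × to g v₁ ≡ w₁

  TwoArcTransitive : Set
  TwoArcTransitive = ∀ {v₀ v₁ v₂ w₀ w₁ w₂} →
    v₀ ⟶ v₁ → v₁ ⟶ v₂ → w₀ ⟶ w₁ → w₁ ⟶ w₂ →
    ∃[ g ] to g v₀ ≡ w₀ × to g v₁ ≡ w₁ × to g v₂ ≡ w₂

------------------------------------------------------------------------
-- Orbits and quotient digraphs

module _ {Γ : Digraph} (N : Subgroup (Aut Γ)) where
  open Digraph Γ
  open Subgroup N
  open Automorphism

  SameOrbit : Rel Vertex 0ℓ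
  SameOrbit v w = ∃[ g ] Member g × to g v ≡ w

  FiniteOrbits : Set
  FiniteOrbits = ∀ v → ∃[ ws ] (∀ w → SameOrbit v w ⇔ w ∈ ws)

  private
    orbit-sym : ∀ {v w} → SameOrbit v w → SameOrbit w v
    orbit-sym {v} (g , g∈N , refl) =
      Group._⁻¹ (Aut Γ) g , ⁻¹-closed g∈N , strictlyInverseʳ g v

    orbit-trans : ∀ {u v w} → SameOrbit u v → SameOrbit v w → SameOrbit u w
    orbit-trans (g , g∈N , refl) (h , h∈N , refl) =
      Group._∙_ (Aut Γ) h g , ∙-closed h∈N g∈N , refl

  -- A vertex of Γ / N, i.e. an orbit, is represented by any of its elements.
  quotientDigraph : SetoidDigraph
  quotientDigraph = record
    { vertices = record
      { Carrier       = Vertex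
      ; _≈_           = SameOrbit
      ; isEquivalence = record
        { refl  = Group.ε (Aut Γ) , ε-closed , refl
        ; sym   = orbit-sym
        ; trans = orbit-trans
        }
      }
    ; _⟶_  = λ a b → ∃[ v ] ∃[ w ] SameOrbit a v × SameOrbit b w × v ⟶ w
    ; resp =
        (λ b∼b′ (v , w , a∼v , b∼w , v⟶w) →
          v , w , a∼v , orbit-trans (orbit-sym b∼b′) b∼w , v⟶w)
      , (λ a∼a′ (v , w , a∼v , b∼w , v⟶w) →
          v , w , orbit-trans (orbit-sym a∼a′) a∼v , b∼w , v⟶w)
    }

------------------------------------------------------------------------
-- Ends

module _ (Γ : Digraph) where
  open Digraph Γ

  record Ray : Set where
    field
      vertex   : ℕ → Vertex
      adjacent : ∀ i → vertex i ─ vertex (ℕ.suc i)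
      distinct : Injective _≡_ _≡_ vertex

  -- A path may consist of a single vertex.
  record Path : Set where
    field
      length   : ℕ
      vertex   : Fin (ℕ.suc length) → Vertex
      adjacent : ∀ (i : Fin length) → vertex (inject₁ i) ─ vertex (suc i)
      distinct : Injective _≡_ _≡_ vertex

    initial terminal : Vertex
    initial  = vertex zero
    terminal = vertex (fromℕ length)

module _ {Γ : Digraph} where
  open Digraph Γ

  infix 4 _OnRay_ _∼_

  _OnRay_ : Vertex → Ray Γ → Set
  v OnRay r = ∃[ i ] Ray.vertex r i ≡ v

  Disjoint : Rel (Path Γ) 0ℓ
  Disjoint p q = ∀ i j → Path.vertex p i ≢ Path.vertex q j

  -- The ends of Γ are the equivalence classes of _∼_.
  _∼_ : Rel (Ray Γ) 0ℓ
  r ∼ s = Σ[ p ∈ (ℕ → Path Γ) ]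
    (∀ {i j} → i ≢ j → Disjoint (p i) (p j)) ×
    (∀ i → Path.initial (p i) OnRay r × Path.terminal (p i) OnRay s)

  infixr 8 _·_

  _·_ : Automorphism Γ → Ray Γ → Ray Γ
  g · r = record
    { vertex   = to ∘ vertex
    ; adjacent = λ i → Sym.gmap to preserves (adjacent i)
    ; distinct = distinct ∘ to-injective
    }
    where
    open Automorphism g
    open Ray r
    to-injective : Injective _≡_ _≡_ to
    to-injective {v} {w} p = ≡.trans (≡.sym (strictlyInverseʳ v))
      (≡.trans (cong from p) (strictlyInverseʳ w))

module _ (Γ : Digraph) where

  TwoEnded : Set
  TwoEnded = Connected Γ ×
    (∃[ r₁ ] ∃[ r₂ ] ¬ (r₁ ∼ r₂) × (∀ (r : Ray Γ) → r ∼ r₁ ⊎ r ∼ r₂))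

  TransitiveOnEnds : Set
  TransitiveOnEnds = ∀ (r s : Ray Γ) → ∃[ g ] g · r ∼ s

  TrivialOnEnds : Set
  TrivialOnEnds = ∀ g (r : Ray Γ) → g · r ∼ r

------------------------------------------------------------------------
-- The two cases

module _ {Γ : Digraph} (N : Subgroup (Aut Γ)) (normal : IsNormal N) where

  CaseI : Set
  CaseI = quotientDigraph N ≅ᴰ discrete ℤ-digraph × quotientGroup N normal ≅ᴳ D∞

  CaseII : Set
  CaseII = quotientDigraph N ≅ᴰ discrete ℤ→-digraph × quotientGroup N normal ≅ᴳ ℤ-group

-- Choose R such that the balls B(x) of radius R separate the two ends, and let
-- c(x, v) be +1, -1 or 0 according as v lies on the side of the first end, on
-- the side of the second end, or on neither side of B(x).  As c(x, v) and
-- c(x, w) differ only if B(x) meets a given path from v to w, the sum over all x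
-- of c(x, v) - c(x, w) is finite; it is the difference of the heights of v and w.
-- Automorphisms preserve height differences up to the sign with which they act
-- on the ends.  If v and w are far apart, then B(x) is disjoint from B(v) or from
-- B(w) for every x, so that all x order v and w the same way and the heights
-- differ: the sets of constant height are finite.  By arc-transitivity the
-- absolute height difference along an arc is constant, and dividing by it gives a
-- level function with steps ±1.  N is the group of automorphisms preserving the
-- levels.  Case (i) or (ii) arises according to whether a vertex has out-neighbours
-- on both adjacent levels or not.
--
-- Local finiteness is not assumed.  Were degrees infinite, a ray could be
-- constructed greedily in any component left by a finite set of vertices, and
-- arc-transitivity provides such a component without rays.

module Submission where

open import Defs
open import Algebra.Bundles using (Group)
open import Algebra.Morphism.Structures using (module GroupMorphisms)
open import Axiom.ExcludedMiddle using (ExcludedMiddle)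
open import Data.Empty using (⊥; ⊥-elim)
open import Data.Fin.Base using (Fin; zero; suc; fromℕ; inject₁)
open import Data.Integer.Base as ℤ using (ℤ; 0ℤ; 1ℤ; -1ℤ; _+_; _*_; _-_; -_)
import Data.Integer.Properties as ℤ
open import Data.Integer.Tactic.RingSolver using (solve-∀)
open import Data.List.Base using (List; []; _∷_; _++_; map; filter; deduplicate; upTo; tabulate; concatMap)
open import Data.List.Membership.Propositional using (_∈_; _∉_; lose)
open import Data.List.Membership.Propositional.Properties
  using ( ∈-map⁺; ∈-map⁻; ∈-++⁺ˡ; ∈-++⁺ʳ; ∈-++⁻; ∈-filter⁺; ∈-filter⁻; ∈-deduplicate⁺
        ; ∈-upTo⁺; ∈-tabulate⁺; ∈-concatMap⁺; finite)
open import Data.List.Membership.Propositional.Properties.WithK using (unique∧set⇒bag)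
open import Data.List.Relation.Binary.BagAndSetEquality using (∼bag⇒↭)
open import Data.List.Relation.Binary.Permutation.Propositional as ↭ using (_↭_)
open import Data.List.Relation.Unary.Any using (here; there)
open import Data.List.Relation.Unary.Unique.Propositional using (Unique)
import Data.List.Relation.Unary.Unique.DecPropositional.Properties as DecUnique
import Data.List.Relation.Unary.Unique.Propositional.Properties as Unique
open import Data.Nat.Base as ℕ
  using (ℕ; zero; suc; _≤_; _<_; _⊔_; z≤n; s≤s; _≤′_; ≤′-refl; ≤′-step)
import Data.Nat.Properties as ℕ
open import Data.Product.Base using (Σ-syntax; ∃-syntax; _×_; _,_; proj₁; proj₂)
open import Data.Sign.Base as Sign using (Sign)
import Data.Sign.Properties as Sign
open import Data.Sum.Base using (_⊎_; inj₁; inj₂; [_,_]′)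
open import Function.Base using (_∘_; id; const)
open import Function.Bundles using (mk⇔; mk↣)
open import Level using (0ℓ)
open import Relation.Binary.Construct.Closure.ReflexiveTransitive using (Star; ε; _◅_)
open import Relation.Binary.Construct.Closure.Symmetric as Sym using (fwd; bwd)
open import Relation.Binary.Definitions using (tri<; tri≈; tri>)
open import Relation.Binary.PropositionalEquality
  using (_≡_; _≢_; refl; sym; trans; cong; cong₂; subst; subst₂; module ≡-Reasoning)
open import Relation.Nullary.Decidable.Core using (Dec; yes; no; ¬?; decidable-stable)
open import Relation.Nullary.Negation using (¬_; contradiction)
open import Relation.Unary using (∁; _⊆_)

-- Signs

*-cancel-self : ∀ s t → s Sign.* (s Sign.* t) ≡ t
*-cancel-self s t = trans (sym (Sign.*-assoc s s t)) (cong (Sign._* t) (Sign.s*s≡+ s))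

◂-distrib-- : ∀ s a b → s ◂ (a - b) ≡ s ◂ a - s ◂ b
◂-distrib-- Sign.+ a b = refl
◂-distrib-- Sign.- a b = neg a b
  where
  neg : ∀ a b → - (a - b) ≡ - a - - b
  neg = solve-∀

◂-zeroʳ : ∀ s → s ◂ 0ℤ ≡ 0ℤ
◂-zeroʳ Sign.+ = refl
◂-zeroʳ Sign.- = refl

◂-◂ : ∀ s t a → (s Sign.* t) ◂ a ≡ s ◂ t ◂ a
◂-◂ Sign.+ t      a = refl
◂-◂ Sign.- Sign.+ a = refl
◂-◂ Sign.- Sign.- a = sym (ℤ.neg-involutive a)

◂-involutive : ∀ s a → s ◂ s ◂ a ≡ a
◂-involutive Sign.+ a = refl
◂-involutive Sign.- a = ℤ.neg-involutive a

◂-comm : ∀ s t a → s ◂ t ◂ a ≡ t ◂ s ◂ a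
◂-comm s t a = trans (sym (◂-◂ s t a)) (trans (cong (_◂ a) (Sign.*-comm s t)) (◂-◂ t s a))

◂-*-assoc : ∀ s a b → s ◂ (a * b) ≡ (s ◂ a) * b
◂-*-assoc Sign.+ a b = refl
◂-*-assoc Sign.- a b = ℤ.neg-distribˡ-* a b

◂1-injective : ∀ {s t} → s ◂ 1ℤ ≡ t ◂ 1ℤ → s ≡ t
◂1-injective {Sign.+} {Sign.+} _ = refl
◂1-injective {Sign.-} {Sign.-} _ = refl

≢⇒≡opposite : ∀ {s t : Sign} → s ≢ t → s ≡ Sign.opposite t
≢⇒≡opposite {Sign.+} {Sign.+} ne = contradiction refl ne
≢⇒≡opposite {Sign.+} {Sign.-} ne = refl
≢⇒≡opposite {Sign.-} {Sign.+} ne = refl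
≢⇒≡opposite {Sign.-} {Sign.-} ne = contradiction refl ne

*-opposite : ∀ s t → s Sign.* Sign.opposite t ≡ Sign.opposite (s Sign.* t)
*-opposite Sign.+ t      = refl
*-opposite Sign.- Sign.+ = refl
*-opposite Sign.- Sign.- = refl

opposite-◂ : ∀ s a → Sign.opposite s ◂ a ≡ - (s ◂ a)
opposite-◂ Sign.+ a = refl
opposite-◂ Sign.- a = sym (ℤ.neg-involutive a)

-- Sums of finitely supported functions

total : {A : Set} → (A → ℤ) → List A → ℤ
total f []       = 0ℤ
total f (x ∷ xs) = f x + total f xs

total-↭ : {A : Set} (f : A → ℤ) {xs ys : List A} → xs ↭ ys → total f xs ≡ total f ys
total-↭ f ↭.refl         = refl
total-↭ f (↭.prep x p)   = cong (f x +_) (total-↭ f p)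
total-↭ f (↭.swap x y p) = trans (swap (f x) (f y) _) (cong (λ t → f y + (f x + t)) (total-↭ f p))
  where
  swap : ∀ a b c → a + (b + c) ≡ b + (a + c)
  swap = solve-∀
total-↭ f (↭.trans p q)  = trans (total-↭ f p) (total-↭ f q)

total-cong : {A : Set} {f g : A → ℤ} → (∀ x → f x ≡ g x) → ∀ xs → total f xs ≡ total g xs
total-cong p []       = refl
total-cong p (x ∷ xs) = cong₂ _+_ (p x) (total-cong p xs)

total-+ : {A : Set} (f g : A → ℤ) → ∀ xs → total (λ x → f x + g x) xs ≡ total f xs + total g xs
total-+ f g []       = refl
total-+ f g (x ∷ xs) = trans (cong (f x + g x +_) (total-+ f g xs)) (exchange (f x) (g x) _ _)
  where
  exchange : ∀ a b c d → a + b + (c + d) ≡ a + c + (b + d)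
  exchange = solve-∀

total-◂ : {A : Set} (s : Sign) (f : A → ℤ) → ∀ xs → total (λ x → s ◂ f x) xs ≡ s ◂ total f xs
total-◂ Sign.+ f xs       = refl
total-◂ Sign.- f []       = refl
total-◂ Sign.- f (x ∷ xs) =
  trans (cong (- f x +_) (total-◂ Sign.- f xs)) (sym (ℤ.neg-distrib-+ (f x) (total f xs)))

total-map : {A B : Set} (f : B → ℤ) (k : A → B) → ∀ xs → total f (map k xs) ≡ total (f ∘ k) xs
total-map f k []       = refl
total-map f k (x ∷ xs) = cong (f (k x) +_) (total-map f k xs)

total-nonNegative : {A : Set} {f : A → ℤ} → (∀ x → 0ℤ ℤ.≤ f x) → ∀ xs → 0ℤ ℤ.≤ total f xs
total-nonNegative p []       = ℤ.≤-refl
total-nonNegative p (x ∷ xs) = ℤ.+-mono-≤ (p x) (total-nonNegative p xs)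

total-positive : {A : Set} {f : A → ℤ} → (∀ x → 0ℤ ℤ.≤ f x) →
  ∀ {x xs} → 0ℤ ℤ.< f x → x ∈ xs → 0ℤ ℤ.< total f xs
total-positive p {xs = _ ∷ xs} q (here refl) = ℤ.+-mono-<-≤ q (total-nonNegative p xs)
total-positive p {xs = y ∷ _}  q (there m)   = ℤ.+-mono-≤-< (p y) (total-positive p q m)

module _ (em : ExcludedMiddle 0ℓ) where

  by-contradiction : {P : Set} → ¬ ¬ P → P
  by-contradiction = decidable-stable em

  ¬∀⇒∃¬ : {A : Set} {P : A → Set} → ¬ (∀ x → P x) → ∃[ x ] ¬ P x
  ¬∀⇒∃¬ ¬all = by-contradiction λ none →
    ¬all (λ x → by-contradiction (λ ¬p → none (x , ¬p)))

  -- The list may be larger than the support, so that several functions can be summed over one list;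
  -- `sum-unique` makes the value independent of it.
  SumIs : {A : Set} → (A → ℤ) → ℤ → Set
  SumIs f n = ∃[ xs ] Unique xs × (∀ x → f x ≢ 0ℤ → x ∈ xs) × total f xs ≡ n

  module _ {A : Set} where

    sum-exists : (f : A → ℤ) → ∀ xs → (∀ x → f x ≢ 0ℤ → x ∈ xs) → ∃[ n ] SumIs f n
    sum-exists f xs supp = _ , deduplicate _≟_ xs , DecUnique.deduplicate-! _≟_ xs ,
      (λ x nz → ∈-deduplicate⁺ _≟_ (supp x nz)) , refl
      where
      _≟_ : (x y : A) → Dec (x ≡ y)
      x ≟ y = em

    private
      nonzero? : (f : A → ℤ) → ∀ x → Dec (f x ≢ 0ℤ)
      nonzero? f x = ¬? (f x ℤ.≟ 0ℤ)

      support : (A → ℤ) → List A → List A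
      support f = filter (nonzero? f)

      total-support : (f : A → ℤ) → ∀ xs → total f (support f xs) ≡ total f xs
      total-support f []       = refl
      total-support f (x ∷ xs) with f x ℤ.≟ 0ℤ
      ... | no  _   = cong (f x +_) (total-support f xs)
      ... | yes f≡0 = trans (total-support f xs)
        (sym (trans (cong (_+ total f xs) f≡0) (ℤ.+-identityˡ _)))

    sum-unique : {f : A → ℤ} {m n : ℤ} → SumIs f m → SumIs f n → m ≡ n
    sum-unique {f} (xs , xs! , xs-supp , refl) (ys , ys! , ys-supp , refl) = begin
      total f xs              ≡⟨ total-support f xs ⟨
      total f (support f xs)  ≡⟨ total-↭ f (∼bag⇒↭ (unique∧set⇒bag (Unique.filter⁺ _ xs!)
                                   (Unique.filter⁺ _ ys!) (mk⇔ (transfer xs ys-supp) (transfer ys xs-supp)))) ⟩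
      total f (support f ys)  ≡⟨ total-support f ys ⟩
      total f ys              ∎
      where
      open ≡-Reasoning
      transfer : ∀ us {vs} → (∀ x → f x ≢ 0ℤ → x ∈ vs) → ∀ {x} → x ∈ support f us → x ∈ support f vs
      transfer us supp {x} x∈ =
        let _ , nz = ∈-filter⁻ (nonzero? f) {xs = us} x∈ in ∈-filter⁺ (nonzero? f) (supp x nz) nz

    sum-cong : {f g : A → ℤ} {n : ℤ} → (∀ x → f x ≡ g x) → SumIs f n → SumIs g n
    sum-cong p (xs , xs! , supp , refl) =
      xs , xs! , (λ x nz → supp x (nz ∘ trans (sym (p x)))) , sym (total-cong p xs)

    sum-+ : {f g : A → ℤ} {m n : ℤ} → SumIs f m → SumIs g n → SumIs (λ x → f x + g x) (m + n)
    sum-+ {f} {g} F@(xs , _ , xs-supp , _) G@(ys , _ , ys-supp , _) = zs , zs! , supp , (begin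
      total _ zs               ≡⟨ total-+ f g zs ⟩
      total f zs + total g zs  ≡⟨ cong₂ _+_
                                    (sum-unique (zs , zs! , (λ x nz → zs-supp (∈-++⁺ˡ (xs-supp x nz))) , refl) F)
                                    (sum-unique (zs , zs! , (λ x nz → zs-supp (∈-++⁺ʳ xs (ys-supp x nz))) , refl) G) ⟩
      _                        ∎)
      where
      open ≡-Reasoning
      _≟_ : (x y : A) → Dec (x ≡ y)
      x ≟ y = em
      -- Both supports lie in this list, so by `sum-unique` either function may be summed over it.
      zs = deduplicate _≟_ (xs ++ ys)
      zs! = DecUnique.deduplicate-! _≟_ (xs ++ ys)
      zs-supp : ∀ {x} → x ∈ xs ++ ys → x ∈ zs
      zs-supp = ∈-deduplicate⁺ _≟_
      supp : ∀ x → f x + g x ≢ 0ℤ → x ∈ zs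
      supp x nz with f x ℤ.≟ 0ℤ
      ... | no f≢0  = zs-supp (∈-++⁺ˡ (xs-supp x f≢0))
      ... | yes f≡0 = zs-supp (∈-++⁺ʳ xs (ys-supp x λ g≡0 → nz (cong₂ _+_ f≡0 g≡0)))

    sum-◂ : (s : Sign) {f : A → ℤ} {n : ℤ} → SumIs f n → SumIs (λ x → s ◂ f x) (s ◂ n)
    sum-◂ s {f} (xs , xs! , supp , refl) =
      xs , xs! , (λ x nz → supp x λ f≡0 → nz (trans (cong (s ◂_) f≡0) (◂-zeroʳ s))) , total-◂ s f xs

    sum-positive : {f : A → ℤ} {n : ℤ} → SumIs f n → (∀ x → 0ℤ ℤ.≤ f x) →
      ∀ x → 0ℤ ℤ.< f x → 0ℤ ℤ.< n
    sum-positive (xs , _ , supp , refl) p x q =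
      total-positive p q (supp x λ eq → ℤ.<-irrefl (sym eq) q)

    sum-reindex : (k k⁻¹ : A → A) → (∀ x → k (k⁻¹ x) ≡ x) → (∀ x → k⁻¹ (k x) ≡ x) →
      {f : A → ℤ} {n : ℤ} → SumIs (f ∘ k) n → SumIs f n
    sum-reindex k k⁻¹ kk⁻¹ k⁻¹k {f} (xs , xs! , supp , refl) =
      map k xs , Unique.map⁺ (λ {x} {y} p → trans (sym (k⁻¹k x)) (trans (cong k⁻¹ p) (k⁻¹k y))) xs! ,
      (λ x nz → subst (_∈ map k xs) (kk⁻¹ x)
        (∈-map⁺ k (supp (k⁻¹ x) (λ eq → nz (trans (cong f (sym (kk⁻¹ x))) eq))))) ,
      total-map f k xs

-- Walks and rays

Finite : {A : Set} → (A → Set) → Set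
Finite P = ∃[ xs ] (∀ x → P x → x ∈ xs)

module _ (em : ExcludedMiddle 0ℓ) {A : Set} where

  -- Each element of the list lies in at most one of the disjoint sets `Q i`, so it suffices to go
  -- beyond finitely many indices. Applied to the vertices of a ray and to a family of disjoint
  -- paths.
  disjoint⇒eventually-avoid : (Q : ℕ → A → Set) → (∀ {i j} → i ≢ j → ∀ x → Q i x → ¬ Q j x) →
    ∀ xs → ∃[ n ] (∀ i → n ≤ i → ∀ x → x ∈ xs → ¬ Q i x)
  disjoint⇒eventually-avoid Q disj []       = 0 , λ _ _ _ ()
  disjoint⇒eventually-avoid Q disj (x ∷ xs)
    with disjoint⇒eventually-avoid Q disj xs | em {P = ∃[ i ] Q i x}
  ... | n , avoid | no none     = n , λ where
    i n≤i _ (here refl) q → none (i , q)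
    i n≤i y (there y∈)  q → avoid i n≤i y y∈ q
  ... | n , avoid | yes (k , q) = n ⊔ suc k , λ where
    i le _ (here refl) q′ → disj (λ { refl → ℕ.<-irrefl refl (ℕ.≤-trans (ℕ.m≤n⊔m n (suc k)) le) }) x q q′
    i le y (there y∈)  q′ → avoid i (ℕ.≤-trans (ℕ.m≤m⊔n n (suc k)) le) y y∈ q′

module Walks (Γ : Digraph) where
  open Digraph Γ

  ─-sym : ∀ {u v} → u ─ v → v ─ u
  ─-sym = Sym.symmetric _⟶_

  data Walk (P : Vertex → Set) : Vertex → Vertex → Set where
    [_]  : ∀ {v} → P v → Walk P v v
    step : ∀ {u v w} → P u → u ─ v → Walk P v w → Walk P u w

  module _ {P : Vertex → Set} where

    start : ∀ {u v} → Walk P u v → P u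
    start [ p ]        = p
    start (step p _ _) = p

    infixr 5 _++ʷ_
    _++ʷ_ : ∀ {u v w} → Walk P u v → Walk P v w → Walk P u w
    [ _ ]      ++ʷ q = q
    step p e r ++ʷ q = step p e (r ++ʷ q)

    reverseʷ : ∀ {u v} → Walk P u v → Walk P v u
    reverseʷ [ p ]        = [ p ]
    reverseʷ (step p e r) = reverseʷ r ++ʷ step (start r) (─-sym e) [ p ]

    mapʷ : ∀ {Q : Vertex → Set} → P ⊆ Q → ∀ {u v} → Walk P u v → Walk Q u v
    mapʷ f [ p ]        = [ f p ]
    mapʷ f (step p e r) = step (f p) e (mapʷ f r)

    -- Strengthens the property carried by a walk: every vertex on it still reaches the end.
    -- `side-nested` uses this to place a whole walk on one side of a ball.
    walk-to-end : ∀ {u v} → Walk P u v → Walk (λ w → Walk P w v) u v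
    walk-to-end [ p ]          = [ [ p ] ]
    walk-to-end r@(step p e q) = step r e (walk-to-end q)

    ray-walk : ∀ (r : Ray Γ) {i j} → i ≤ j → (∀ k → i ≤ k → P (Ray.vertex r k)) →
      Walk P (Ray.vertex r i) (Ray.vertex r j)
    ray-walk r i≤j tail = go (ℕ.≤⇒≤′ i≤j)
      where
      go : ∀ {j} → _ ≤′ j → Walk P _ (Ray.vertex r j)
      go ≤′-refl         = [ tail _ ℕ.≤-refl ]
      go (≤′-step {n} q) = go q ++ʷ
        step (tail n (ℕ.≤′⇒≤ q)) (Ray.adjacent r n) [ tail (suc n) (ℕ.m≤n⇒m≤1+n (ℕ.≤′⇒≤ q)) ]

    path-walk : (p : Path Γ) → (∀ i → P (Path.vertex p i)) → Walk P (Path.initial p) (Path.terminal p)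
    path-walk p = go (Path.length p) (Path.vertex p) (Path.adjacent p)
      where
      go : ∀ n (f : Fin (suc n) → Vertex) → (∀ i → f (inject₁ i) ─ f (suc i)) →
        (∀ i → P (f i)) → Walk P (f zero) (f (fromℕ n))
      go zero    f adj ps = [ ps zero ]
      go (suc n) f adj ps = step (ps zero) (adj zero) (go n (f ∘ suc) (adj ∘ suc) (ps ∘ suc))

  module _ (g : Automorphism Γ) where
    open Automorphism g

    to-─ : ∀ {u v} → u ─ v → to u ─ to v
    to-─ = Sym.gmap to preserves

    from-─ : ∀ {u v} → to u ─ to v → u ─ v
    from-─ (fwd a) = fwd (reflects a)
    from-─ (bwd a) = bwd (reflects a)

    to-walk : ∀ {P Q} → (∀ v → P v → Q (to v)) → ∀ {u v} → Walk P u v → Walk Q (to u) (to v)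
    to-walk f [ p ]        = [ f _ p ]
    to-walk f (step p e r) = step (f _ p) (to-─ e) (to-walk f r)

    from-walk : ∀ {P Q} → (∀ v → P (to v) → Q v) → ∀ {u v} → Walk P (to u) (to v) → Walk Q u v
    from-walk {P} {Q} f {u} {v} r = subst₂ (Walk Q) (strictlyInverseʳ u) (strictlyInverseʳ v) (go r)
      where
      f′ : ∀ v → P v → Q (from v)
      f′ v p = f (from v) (subst P (sym (strictlyInverseˡ v)) p)
      go : ∀ {u v} → Walk P u v → Walk Q (from u) (from v)
      go [ p ]        = [ f′ _ p ]
      go (step p e r) = step (f′ _ p)
        (from-─ (subst₂ _─_ (sym (strictlyInverseˡ _)) (sym (strictlyInverseˡ _)) e)) (go r)

  private
    suffix : (p : Path Γ) (i : Fin (suc (Path.length p))) →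
      Σ[ q ∈ Path Γ ] Path.initial q ≡ Path.vertex p i × Path.terminal q ≡ Path.terminal p ×
        (∀ j → ∃[ k ] Path.vertex q j ≡ Path.vertex p k)
    suffix p zero = p , refl , refl , λ j → j , refl
    suffix p@record { length = suc n } (suc i) =
      let q , eq₀ , eq₁ , sub = suffix p′ i
      in q , eq₀ , eq₁ , λ j → let k , eq = sub j in suc k , eq
      where
      open Path p using (vertex; adjacent; distinct)
      suc-injective : ∀ {n} {i j : Fin n} → Fin.suc i ≡ suc j → i ≡ j
      suc-injective refl = refl
      p′ : Path Γ
      p′ = record
        { length   = n
        ; vertex   = vertex ∘ suc
        ; adjacent = adjacent ∘ suc
        ; distinct = suc-injective ∘ distinct
        }

    cons : ∀ u (p : Path Γ) → u ─ Path.initial p → (∀ i → Path.vertex p i ≢ u) → Path Γ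
    cons u p e new = record
      { length   = suc length
      ; vertex   = f
      ; adjacent = λ { zero → e ; (suc i) → adjacent i }
      ; distinct = inj
      }
      where
      open Path p
      f : Fin (suc (suc length)) → Vertex
      f zero    = u
      f (suc i) = vertex i
      inj : ∀ {i j} → f i ≡ f j → i ≡ j
      inj {zero}  {zero}  _  = refl
      inj {zero}  {suc j} eq = ⊥-elim (new j (sym eq))
      inj {suc i} {zero}  eq = ⊥-elim (new i eq)
      inj {suc i} {suc j} eq = cong suc (distinct eq)

  module LoopErasure (em : ExcludedMiddle 0ℓ) where

    -- Loop erasure by recursion: if `u` already occurs on the path found for the rest of the walk,
    -- the suffix from that occurrence is kept; otherwise `u` is put in front.
    walk⇒path : ∀ {P u v} → Walk P u v →
      Σ[ p ∈ Path Γ ] Path.initial p ≡ u × Path.terminal p ≡ v × (∀ i → P (Path.vertex p i))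
    walk⇒path {u = u} [ pu ] = record
      { length   = 0
      ; vertex   = λ _ → u
      ; adjacent = λ ()
      ; distinct = λ { {zero} {zero} _ → refl }
      } , refl , refl , λ _ → pu
    walk⇒path {P} {u} (step pu e r) with walk⇒path r
    ... | p , eqᵢ , eqₜ , inP with em {P = ∃[ i ] Path.vertex p i ≡ u}
    ...   | yes (i , eq) =
      let q , eq₀ , eq₁ , sub = suffix p i
      in q , trans eq₀ eq , trans eq₁ eqₜ , λ j → let k , eq′ = sub j in subst P (sym eq′) (inP k)
    ...   | no new = cons u p (subst (u ─_) (sym eqᵢ) e) (λ i eq → new (i , eq)) , refl , eqₜ , λ { zero → pu ; (suc i) → inP i }

module Rays (em : ExcludedMiddle 0ℓ) (Γ : Digraph) where
  open Digraph Γ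
  open Walks Γ
  open LoopErasure em
  open Ray using (vertex)

  Tail : Ray Γ → (Vertex → Set) → ℕ → Set
  Tail r F i = ∀ j → i ≤ j → ¬ F (vertex r j)

  tail-mono : ∀ {r F i j} → i ≤ j → Tail r F i → Tail r F j
  tail-mono i≤j t k j≤k = t k (ℕ.≤-trans i≤j j≤k)

  tail-exists : ∀ r F → Finite F → ∃[ i ] Tail r F i
  tail-exists r F (xs , cover) =
    let n , avoid = disjoint⇒eventually-avoid em (λ i v → vertex r i ≡ v)
                      (λ { i≢j _ refl eq → i≢j (sym (Ray.distinct r eq)) }) xs
    in n , λ j n≤j f → avoid j n≤j _ (cover _ f) refl

  tails-joined : ∀ r {F i j} → Tail r F i → Tail r F j → Walk (∁ F) (vertex r i) (vertex r j)
  tails-joined r {i = i} {j} t t′ =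
    ray-walk r (ℕ.m≤m⊔n i j) t ++ʷ reverseʷ (ray-walk r (ℕ.m≤n⊔m i j) t′)

  -- For finite `F`, this is the component of the complement of `F` that contains a tail of `r`.
  Toward : Ray Γ → (Vertex → Set) → Vertex → Set
  Toward r F v = ∃[ i ] Tail r F i × Walk (∁ F) v (vertex r i)

  toward-walk : ∀ r {F u v} → Walk (∁ F) u v → Toward r F v → Toward r F u
  toward-walk r p (i , t , q) = i , t , p ++ʷ q

  toward-avoids : ∀ r {F v} → Toward r F v → ¬ F v
  toward-avoids r (_ , _ , q) = start q

  toward-mono : ∀ {r F F′ v} → F ⊆ F′ → Toward r F′ v → Toward r F v
  toward-mono sub (i , t , q) = i , (λ j le → t j le ∘ sub) , mapʷ (λ ¬f → ¬f ∘ sub) q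

  -- Equivalent to _∼_, but more easily seen to be transitive.
  infix 4 _≋_
  record _≋_ (r s : Ray Γ) : Set where
    field meet : ∀ xs → ∃[ v ] Toward r (_∈ xs) v × Toward s (_∈ xs) v
  open _≋_

  -- A vertex obtained from `meet` joins tails of `r` and `s` outside `xs`, hence outside `F`, so
  -- both tails lie in one component of the complement of `F`.
  toward-resp : ∀ {r s F v} → r ≋ s → Finite F → Toward r F v → Toward s F v
  toward-resp {r} {s} {F} r≋s (xs , cover) (i , t , p) =
    let _ , r∋w , s∋w = meet r≋s xs
        (j , t′ , q)  = toward-mono {r} {F} (λ {v} → cover v) r∋w
    in toward-walk s (p ++ʷ tails-joined r {F} t t′ ++ʷ reverseʷ q) (toward-mono {s} {F} (λ {v} → cover v) s∋w)

  ≋-refl : ∀ {r} → r ≋ r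
  ≋-refl {r} .meet xs = let i , t = tail-exists r (_∈ xs) (xs , λ _ → id) in
    vertex r i , (i , t , [ t i ℕ.≤-refl ]) , (i , t , [ t i ℕ.≤-refl ])

  ≋-sym : ∀ {r s} → r ≋ s → s ≋ r
  ≋-sym r≋s .meet xs = let v , p , q = meet r≋s xs in v , q , p

  ≋-trans : ∀ {r s t} → r ≋ s → s ≋ t → r ≋ t
  ≋-trans r≋s s≋t .meet xs = let v , p , q = meet r≋s xs in
    v , p , toward-resp s≋t (xs , λ _ → id) q

  toward-map : ∀ g {r F F′ v} → (∀ w → F′ (Automorphism.to g w) → F w) →
    Toward r F v → Toward (g · r) F′ (Automorphism.to g v)
  toward-map g f (i , t , q) = i , (λ j le → t j le ∘ f _) , to-walk g (λ w ¬f → ¬f ∘ f w) q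

  toward-unmap : ∀ g {r F F′ v} → (∀ w → F w → F′ (Automorphism.to g w)) →
    Toward (g · r) F′ (Automorphism.to g v) → Toward r F v
  toward-unmap g f (i , t , q) = i , (λ j le → t j le ∘ f _) , from-walk g (λ w ¬f → ¬f ∘ f w) q

  ≋-map : ∀ g {r s} → r ≋ s → g · r ≋ g · s
  ≋-map g {r} {s} r≋s .meet xs =
    let v , p , q = meet r≋s (map from xs) in
    to v , toward-map g {r} pull p , toward-map g {s} pull q
    where
    open Automorphism g
    pull : ∀ w → to w ∈ xs → w ∈ map from xs
    pull w m = subst (_∈ _) (strictlyInverseʳ w) (∈-map⁺ from m)

  ≋-unmap : ∀ g {r s} → g · r ≋ g · s → r ≋ s
  ≋-unmap g {r} {s} eq .meet xs =
    let v , p , q = meet eq (map to xs)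
        v≡ = sym (strictlyInverseˡ v)
    in from v , toward-unmap g {r} (λ _ → ∈-map⁺ to) (subst (Toward (g · r) _) v≡ p)
              , toward-unmap g {s} (λ _ → ∈-map⁺ to) (subst (Toward (g · s) _) v≡ q)
    where open Automorphism g

  ∼⇒≋ : ∀ {r s} → r ∼ s → r ≋ s
  ∼⇒≋ {r} {s} (p , disj , ends) .meet xs with tail-exists r (_∈ xs) (xs , λ _ → id) | tail-exists s (_∈ xs) (xs , λ _ → id)
  ... | i , t | j , t′ =
    let n , avoid = disjoint⇒eventually-avoid em (λ k v → ∃[ l ] Path.vertex (p k) l ≡ v)
                      (λ { k≢l _ (a , refl) (b , eq) → disj k≢l a b (sym eq) }) ys
        (i′ , eq) , (j′ , eq′) = ends n
        avoids   = λ l m → avoid n ℕ.≤-refl _ m (l , refl)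
        i≤i′ = ℕ.≮⇒≥ λ lt → avoids zero (subst (_∈ ys) eq
                 (∈-++⁺ˡ (∈-map⁺ (vertex r) (∈-upTo⁺ lt))))
        j≤j′ = ℕ.≮⇒≥ λ lt → avoids (fromℕ _) (subst (_∈ ys) eq′
                 (∈-++⁺ʳ (map (vertex r) (upTo i)) (∈-++⁺ˡ (∈-map⁺ (vertex s) (∈-upTo⁺ lt)))))
        walk = subst₂ (Walk _) (sym eq) (sym eq′) (path-walk (p n) (λ l m → avoids l (inXs m)))
        tr = tail-mono {r} {_∈ xs} i≤i′ t
    in vertex r i′ , (i′ , tr , [ tr i′ ℕ.≤-refl ]) , (j′ , tail-mono {s} {_∈ xs} j≤j′ t′ , walk)
    where
    -- The segments of the rays before their tails are avoided as well, so that the chosen path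
    -- starts and ends on the tails.
    ys = map (vertex r) (upTo i) ++ map (vertex s) (upTo j) ++ xs
    inXs : ∀ {v} → v ∈ xs → v ∈ ys
    inXs m = ∈-++⁺ʳ (map (vertex r) (upTo i)) (∈-++⁺ʳ (map (vertex s) (upTo j)) m)

  -- The disjoint paths are chosen greedily, each avoiding the earlier ones.
  ≋⇒∼ : ∀ {r s} → r ≋ s → r ∼ s
  ≋⇒∼ {r} {s} r≋s = path , disjoint , λ i → proj₁ (proj₂ (next (used i)))
    where
    next : ∀ xs → Σ[ p ∈ Path Γ ] (Path.initial p OnRay r × Path.terminal p OnRay s) ×
      (∀ l → Path.vertex p l ∉ xs)
    next xs =
      let _ , (i , t , p) , (j , t′ , q) = meet r≋s xs
          path , eq , eq′ , avoids = walk⇒path (reverseʷ p ++ʷ q)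
      in path , ((i , sym eq) , (j , sym eq′)) , avoids

    used : ℕ → List Vertex
    path : ℕ → Path Γ
    used zero    = []
    used (suc n) = tabulate (Path.vertex (path n)) ++ used n
    path n       = proj₁ (next (used n))

    used-path : ∀ i {j} → suc i ≤′ j → ∀ l → Path.vertex (path i) l ∈ used j
    used-path i ≤′-refl         l = ∈-++⁺ˡ (∈-tabulate⁺ {f = Path.vertex (path i)} l)
    used-path i (≤′-step {n} q) l = ∈-++⁺ʳ (tabulate (Path.vertex (path n))) (used-path i q l)

    earlier-disjoint : ∀ {i j} → i < j → Disjoint (path i) (path j)
    earlier-disjoint {i} {j} i<j k l eq =
      proj₂ (proj₂ (next (used j))) l (subst (_∈ used j) eq (used-path i (ℕ.≤⇒≤′ i<j) k))

    disjoint : ∀ {i j} → i ≢ j → Disjoint (path i) (path j)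
    disjoint {i} {j} i≢j with ℕ.<-cmp i j
    ... | tri< lt _ _ = earlier-disjoint lt
    ... | tri≈ _ eq _ = contradiction eq i≢j
    ... | tri> _ _ gt = λ k l eq → earlier-disjoint gt l k (sym eq)

-- The two ends

module Ends (em : ExcludedMiddle 0ℓ) (Γ : Digraph) (r₁ r₂ : Ray Γ)
  (r₁≁r₂ : ¬ (r₁ ∼ r₂)) (r₁-or-r₂ : ∀ (r : Ray Γ) → r ∼ r₁ ⊎ r ∼ r₂) where

  open Digraph Γ
  open Walks Γ
  open Rays em Γ
  open _≋_
  open Automorphism using (to; from; strictlyInverseˡ; strictlyInverseʳ)

  end : Sign → Ray Γ
  end Sign.+ = r₁
  end Sign.- = r₂

  end-of : ∀ r → ∃[ s ] r ≋ end s
  end-of r with r₁-or-r₂ r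
  ... | inj₁ p = Sign.+ , ∼⇒≋ p
  ... | inj₂ p = Sign.- , ∼⇒≋ p

  private
    +≢- : ¬ (end Sign.+ ≋ end Sign.-)
    +≢- p = r₁≁r₂ (≋⇒∼ p)

    -- If `g` sent both rays to the same end, `≋-unmap` would make the two ends equal. Hence `g`
    -- either fixes or exchanges them.
    action : ∀ g → ∃[ s ] (∀ t → g · end t ≋ end (s Sign.* t))
    action g with end-of (g · r₁) | end-of (g · r₂)
    ... | Sign.+ , p | Sign.+ , q = contradiction (≋-unmap g (≋-trans p (≋-sym q))) +≢-
    ... | Sign.+ , p | Sign.- , q = Sign.+ , λ { Sign.+ → p ; Sign.- → q }
    ... | Sign.- , p | Sign.+ , q = Sign.- , λ { Sign.+ → p ; Sign.- → q }
    ... | Sign.- , p | Sign.- , q = contradiction (≋-unmap g (≋-trans p (≋-sym q))) +≢-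

  sgn : Automorphism Γ → Sign
  sgn g = proj₁ (action g)

  sgn-end : ∀ g t → g · end t ≋ end (sgn g Sign.* t)
  sgn-end g = proj₂ (action g)

  end-sgn : ∀ g t → end t ≋ g · end (sgn g Sign.* t)
  end-sgn g t = subst (λ s → end s ≋ g · end (sgn g Sign.* t)) (*-cancel-self (sgn g) t)
    (≋-sym (sgn-end g (sgn g Sign.* t)))

  toward-end-map : ∀ g {s F F′ v} → Finite F′ → (∀ w → F′ (to g w) → F w) →
    Toward (end s) F v → Toward (end (sgn g Sign.* s)) F′ (to g v)
  toward-end-map g {s} fin f = toward-resp (sgn-end g s) fin ∘ toward-map g {end s} f

  toward-end-unmap : ∀ g {s F F′ v} → Finite F′ → (∀ w → F w → F′ (to g w)) →
    Toward (end s) F′ (to g v) → Toward (end (sgn g Sign.* s)) F v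
  toward-end-unmap g {s} fin f = toward-unmap g {end _} f ∘ toward-resp (end-sgn g s) fin

  Separates : (Vertex → Set) → Set
  Separates F = ∀ {s t v} → Toward (end s) F v → Toward (end t) F v → s ≡ t

  separates-mono : ∀ {F F′} → F ⊆ F′ → Separates F → Separates F′
  separates-mono sub sep {s} {t} p q =
    sep (toward-mono {end s} sub p) (toward-mono {end t} sub q)

  -- If every finite set left a vertex joined to tails of both rays, these vertices would prove the
  -- two rays equivalent.
  finite-separator : ∃[ xs ] Separates (_∈ xs)
  finite-separator =
    let xs , ¬common = ¬∀⇒∃¬ em (λ all → +≢- (record { meet = all })) in xs , separates ¬common
    where
    separates : ∀ {F} → ¬ (∃[ v ] Toward r₁ F v × Toward r₂ F v) → Separates F
    separates ¬common {Sign.+} {Sign.+} p q = refl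
    separates ¬common {Sign.+} {Sign.-} p q = contradiction (_ , p , q) ¬common
    separates ¬common {Sign.-} {Sign.+} p q = contradiction (_ , q , p) ¬common
    separates ¬common {Sign.-} {Sign.-} p q = refl

  -- Vertices dominating an end, and local finiteness

  Dominates : Sign → Vertex → Set
  Dominates s v = ∀ xs → v ∉ xs → Toward (end s) (_∈ xs) v

  private
    ∈-map-from : ∀ (g : Automorphism Γ) {v xs} → to g v ∈ xs → v ∈ map (from g) xs
    ∈-map-from g {v} m = subst (_∈ _) (strictlyInverseʳ g v) (∈-map⁺ (from g) m)

    ∈-map-from⁻ : ∀ (g : Automorphism Γ) {v xs} → v ∈ map (from g) xs → to g v ∈ xs
    ∈-map-from⁻ g m with ∈-map⁻ (from g) m
    ... | w , w∈ , refl = subst (_∈ _) (sym (strictlyInverseˡ g w)) w∈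

    ∈-map-to⁻ : ∀ (g : Automorphism Γ) {v xs} → to g v ∈ map (to g) xs → v ∈ xs
    ∈-map-to⁻ g {v} m with ∈-map⁻ (to g) m
    ... | w , w∈ , eq = subst (_∈ _)
      (trans (sym (strictlyInverseʳ g w)) (trans (cong (from g) (sym eq)) (strictlyInverseʳ g v))) w∈

  dominates-map : ∀ g {s v} → Dominates s v → Dominates (sgn g Sign.* s) (to g v)
  dominates-map g dom xs v∉ =
    toward-end-map g (xs , λ _ → id) (λ _ → ∈-map-from g)
      (dom (map (from g) xs) (v∉ ∘ ∈-map-from⁻ g))

  dominates-unmap : ∀ g {s v} → Dominates s (to g v) → Dominates (sgn g Sign.* s) v
  dominates-unmap g dom xs v∉ =
    toward-end-unmap g (map (to g) xs , λ _ → id) (λ _ → ∈-map⁺ (to g))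
      (dom (map (to g) xs) (v∉ ∘ ∈-map-to⁻ g))

  DominatesOnly : Sign → Vertex → Set
  DominatesOnly s v = Dominates s v × (∀ t → Dominates t v → t ≡ s)

  dominatesOnly-map : ∀ g {s v} → DominatesOnly s v → DominatesOnly (sgn g Sign.* s) (to g v)
  dominatesOnly-map g {s} (dom , only) = dominates-map g dom , λ t d →
    trans (sym (*-cancel-self (sgn g) t)) (cong (sgn g Sign.*_) (only _ (dominates-unmap g d)))

  -- Otherwise every vertex dominates exactly one end: adjacent vertices far out
  -- on a ray dominate the same end, hence, by arc-transitivity, so do any two
  -- adjacent vertices, and connectedness leaves only one end to be dominated.
  undominating-vertex : Connected Γ → ArcTransitive Γ → ∃[ v ] (∀ s → ¬ Dominates s v)
  undominating-vertex conn arcTrans = by-contradiction em λ none →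
    let dominating : ∀ v → ∃[ s ] Dominates s v
        dominating v = by-contradiction em λ no-end → none (v , λ s d → no-end (s , d))
    in absurd dominating
    where
    S = proj₁ finite-separator

    module _ (dominating : ∀ v → ∃[ s ] Dominates s v) where

      -- If `v` dominates an end `t`, then, being outside `S`, it lies on the side of `t`. Since `S`
      -- separates the ends, `t` is the end on whose side `v` already lies.
      toward⇒dominatesOnly : ∀ s {v} → Toward (end s) (_∈ S) v → DominatesOnly s v
      toward⇒dominatesOnly s {v} p =
        let t , d = dominating v in subst (λ t → Dominates t v) (only t d) d , only
        where
        only : ∀ t → Dominates t v → t ≡ s
        only t d = proj₂ finite-separator (d S (toward-avoids (end s) p)) p

      far : ∀ s → ∃[ i ] (∀ j → i ≤ j → DominatesOnly s (Ray.vertex (end s) j))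
      far s = let i , t = tail-exists (end s) (_∈ S) (S , λ _ → id) in
        i , λ j i≤j → toward⇒dominatesOnly s
          (j , tail-mono {end s} {_∈ S} i≤j t , [ t j i≤j ])

      SameType : Vertex → Vertex → Set
      SameType v w = ∃[ s ] DominatesOnly s v × DominatesOnly s w

      sameType-transfer : ∀ {a b} → a ─ b → SameType a b → ∀ {v w} → v ⟶ w → SameType v w
      sameType-transfer (bwd b⟶a) (s , da , db) v⟶w = sameType-transfer (fwd b⟶a) (s , db , da) v⟶w
      sameType-transfer (fwd a⟶b) (s , da , db) v⟶w with arcTrans a⟶b v⟶w
      ... | g , refl , refl = sgn g Sign.* s , dominatesOnly-map g da , dominatesOnly-map g db

      sameType-arc : ∀ {v w} → v ⟶ w → SameType v w
      sameType-arc =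
        let i , dom = far Sign.+
        in sameType-transfer (Ray.adjacent r₁ i) (Sign.+ , dom i ℕ.≤-refl , dom (suc i) (ℕ.n≤1+n i))

      spread : ∀ {v w s} → Star _─_ v w → DominatesOnly s v → DominatesOnly s w
      spread ε d = d
      spread (fwd a ◅ p) (d , _) = let t , (_ , only) , dw = sameType-arc a in
        spread p (subst (λ s → DominatesOnly s _) (sym (only _ d)) dw)
      spread (bwd a ◅ p) (d , _) = let t , dw , (_ , only) = sameType-arc a in
        spread p (subst (λ s → DominatesOnly s _) (sym (only _ d)) dw)

      absurd : ⊥
      absurd =
        let i , dom  = far Sign.+
            j , dom′ = far Sign.-
        in Sign.s≢opposite[s] Sign.+
             (proj₂ (dom′ j ℕ.≤-refl) Sign.+ (proj₁ (spread (conn _ _) (dom i ℕ.≤-refl))))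

  LocallyFinite : Set
  LocallyFinite = ∀ v → Finite (v ─_)

  private
    module GreedyRay (x : Vertex) (F : List Vertex) (x∉F : x ∉ F)
      (fresh : ∀ w xs → ∃[ u ] w ─ u × u ∉ xs) where

      current : ℕ → Vertex
      avoided : ℕ → List Vertex
      current zero    = x
      current (suc n) = proj₁ (fresh (current n) (avoided n))
      avoided zero    = x ∷ F
      avoided (suc n) = current (suc n) ∷ avoided n

      avoided-mono : ∀ {m n} → m ≤′ n → ∀ {u} → u ∈ avoided m → u ∈ avoided n
      avoided-mono ≤′-refl     = id
      avoided-mono (≤′-step p) = there ∘ avoided-mono p

      current-avoided : ∀ n → current n ∈ avoided n
      current-avoided zero    = here refl
      current-avoided (suc n) = here refl

      new : ∀ n → current (suc n) ∉ avoided n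
      new n = proj₂ (proj₂ (fresh (current n) (avoided n)))

      earlier-distinct : ∀ {i j} → i < j → current i ≢ current j
      earlier-distinct {i} {suc j} (s≤s i≤j) eq =
        new j (subst (_∈ avoided j) eq (avoided-mono (ℕ.≤⇒≤′ i≤j) (current-avoided i)))

      ray : Ray Γ
      ray = record
        { vertex   = current
        ; adjacent = λ i → proj₁ (proj₂ (fresh (current i) (avoided i)))
        ; distinct = λ {i} {j} → injective i j
        }
        where
        injective : ∀ i j → current i ≡ current j → i ≡ j
        injective i j eq with ℕ.<-cmp i j
        ... | tri< lt _ _  = contradiction eq (earlier-distinct lt)
        ... | tri≈ _ i≡j _ = i≡j
        ... | tri> _ _ gt  = contradiction (sym eq) (earlier-distinct gt)

      ray-avoids : ∀ n → current n ∉ F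
      ray-avoids zero    = x∉F
      ray-avoids (suc n) = new n ∘ avoided-mono (ℕ.≤⇒≤′ (z≤n {n})) ∘ there

      -- The ray starts at `x` and never enters `F`, and like every ray it belongs to one of the two
      -- ends.
      toward-some-end : ∃[ s ] Toward (end s) (_∈ F) x
      toward-some-end =
        let s , ray≋s = end-of ray
        in s , toward-resp ray≋s (F , λ _ → id) (0 , (λ j _ → ray-avoids j) , [ x∉F ])

  -- Each end has a finite set separating `v` from it; the union of the two sets serves for both.
  undominating-separator : ∀ {v} → (∀ s → ¬ Dominates s v) →
    ∃[ xs ] v ∉ xs × (∀ s → ¬ Toward (end s) (_∈ xs) v)
  undominating-separator {v} ¬dom = combine (separator Sign.+) (separator Sign.-)
    where
    separator : ∀ s → ∃[ xs ] v ∉ xs × ¬ Toward (end s) (_∈ xs) v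
    separator s =
      let xs , ¬imp = ¬∀⇒∃¬ em (¬dom s)
      in xs , (λ v∈ → ¬imp (contradiction v∈)) , λ p → ¬imp (const p)

    combine : ∃[ xs ] v ∉ xs × ¬ Toward (end Sign.+) (_∈ xs) v →
      ∃[ ys ] v ∉ ys × ¬ Toward (end Sign.-) (_∈ ys) v → _
    combine (xs , v∉xs , ¬t) (ys , v∉ys , ¬t′) =
      xs ++ ys , ([ v∉xs , v∉ys ]′ ∘ ∈-++⁻ xs) , λ where
        Sign.+ → ¬t ∘ toward-mono {end Sign.+} ∈-++⁺ˡ
        Sign.- → ¬t′ ∘ toward-mono {end Sign.-} (∈-++⁺ʳ xs)

  -- If one vertex had infinitely many neighbours, all would. A greedy ray could then start at an
  -- undominating vertex and avoid the finite set that cuts this vertex off from both ends.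
  locally-finite : Connected Γ → VertexTransitive Γ → ArcTransitive Γ → LocallyFinite
  locally-finite conn vertexTrans arcTrans v = by-contradiction em λ ¬fin →
    let x , ¬dom = undominating-vertex conn arcTrans
        F , x∉F , ¬toward = undominating-separator ¬dom
        s , t = GreedyRay.toward-some-end x F x∉F (infinite-degree ¬fin)
    in ¬toward s t
    where
    infinite-degree : ¬ Finite (v ─_) → ∀ w xs → ∃[ u ] w ─ u × u ∉ xs
    infinite-degree ¬fin w xs with vertexTrans v w
    ... | g , refl = by-contradiction em λ none → ¬fin (map (from g) xs , λ u v─u →
      by-contradiction em λ u∉ → none (to g u , to-─ g v─u , u∉ ∘ ∈-map-from g))

-- Heights

module Balls (Γ : Digraph) where
  open Digraph Γ
  open Walks Γ

  -- `centre` is available at every radius, so that the radius is only an upper bound for the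
  -- distance and balls grow with it.
  data Ball (x : Vertex) : ℕ → Vertex → Set where
    centre : ∀ {n} → Ball x n x
    grow   : ∀ {n v w} → Ball x n v → v ─ w → Ball x (suc n) w

  ball-mono : ∀ {x m n v} → m ≤ n → Ball x m v → Ball x n v
  ball-mono _         centre     = centre
  ball-mono (s≤s m≤n) (grow b e) = grow (ball-mono m≤n b) e

  ball-trans : ∀ {x y z m n} → Ball x m y → Ball y n z → Ball x (m ℕ.+ n) z
  ball-trans {m = m} {n} b centre = ball-mono (ℕ.m≤m+n m n) b
  ball-trans {x} {z = z} {m} {suc n} b (grow c e) =
    subst (λ k → Ball x k z) (sym (ℕ.+-suc m n)) (grow (ball-trans b c) e)

  ball-cons : ∀ {x y n v} → x ─ y → Ball y n v → Ball x (suc n) v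
  ball-cons e centre     = grow centre e
  ball-cons e (grow b f) = grow (ball-cons e b) f

  ball-sym : ∀ {x n v} → Ball x n v → Ball v n x
  ball-sym centre     = centre
  ball-sym (grow b e) = ball-cons (─-sym e) (ball-sym b)

  ball-walk : ∀ {x n v} → Ball x n v → Walk (Ball x n) x v
  ball-walk centre       = [ centre ]
  ball-walk b′@(grow b e) = mapʷ (ball-mono (ℕ.n≤1+n _)) (ball-walk b)
    ++ʷ step (ball-mono (ℕ.n≤1+n _) b) e [ b′ ]

  in-some-ball : ∀ {x v} → Star _─_ x v → ∃[ n ] Ball x n v
  in-some-ball ε       = 0 , centre
  in-some-ball (e ◅ p) = let n , b = in-some-ball p in suc n , ball-cons e b

  list-in-ball : Connected Γ → ∀ x vs → ∃[ n ] (∀ {v} → v ∈ vs → Ball x n v)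
  list-in-ball conn x []       = 0 , λ ()
  list-in-ball conn x (v ∷ vs) =
    let m , b  = in-some-ball (conn x v)
        n , bs = list-in-ball conn x vs
    in m ⊔ n , λ where
      (here refl) → ball-mono (ℕ.m≤m⊔n m n) b
      (there v∈)  → ball-mono (ℕ.m≤n⊔m m n) (bs v∈)

  ball-map : (g : Automorphism Γ) (let open Automorphism g) → ∀ {x n v} →
    Ball x n v → Ball (to x) n (to v)
  ball-map g centre     = centre
  ball-map g (grow b e) = grow (ball-map g b) (to-─ g e)

  ball-unmap : (g : Automorphism Γ) (let open Automorphism g) → ∀ {x n v} →
    Ball (to x) n (to v) → Ball x n v
  ball-unmap g {x} {n} {v} b =
    subst₂ (λ x v → Ball x n v) (strictlyInverseʳ x) (strictlyInverseʳ v) (go b)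
    where
    open Automorphism g
    go : ∀ {x n v} → Ball x n v → Ball (from x) n (from v)
    go centre     = centre
    go (grow b e) = grow (go b)
      (from-─ g (subst₂ _─_ (sym (strictlyInverseˡ _)) (sym (strictlyInverseˡ _)) e))

  ball-finite : (∀ v → Finite (v ─_)) → ∀ x n → Finite (Ball x n)
  ball-finite locFin x zero    = x ∷ [] , λ { _ centre → here refl }
  ball-finite locFin x (suc n) =
    let vs , cover = ball-finite locFin x n
        nbrs v = proj₁ (locFin v)
    in x ∷ concatMap nbrs vs , λ where
      _ centre           → here refl
      w (grow {v = v} b e) →
        there (∈-concatMap⁺ nbrs (lose (cover v b) (proj₂ (locFin v) w e)))

module Height (em : ExcludedMiddle 0ℓ) (Γ : Digraph) (r₁ r₂ : Ray Γ)
  (r₁≁r₂ : ¬ (r₁ ∼ r₂)) (r₁-or-r₂ : ∀ (r : Ray Γ) → r ∼ r₁ ⊎ r ∼ r₂)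
  (conn : Connected Γ) (locFin : ∀ v → Finite (Digraph._─_ Γ v)) where

  open Digraph Γ
  open Walks Γ
  open Rays em Γ
  open Ends em Γ r₁ r₂ r₁≁r₂ r₁-or-r₂
  open Balls Γ
  open Automorphism using (to; from; strictlyInverseˡ; strictlyInverseʳ)

  -- A ball around `o` that contains a finite separator separates the ends, and automorphisms carry
  -- it to the ball of the same radius around any vertex.
  separating-radius : VertexTransitive Γ → ∃[ R ] (∀ x → Separates (Ball x R))
  separating-radius vertexTrans = R , λ x →
    let g , eq = vertexTrans o x in subst (λ x → Separates (Ball x R)) eq (λ {s} {t} → translate g {s} {t})
    where
    o = Ray.vertex r₁ 0
    S = proj₁ finite-separator
    R = proj₁ (list-in-ball conn o S)
    ball-o : Separates (Ball o R)
    ball-o = separates-mono (proj₂ (list-in-ball conn o S)) (proj₂ finite-separator)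
    translate : ∀ g → Separates (Ball (to g o) R)
    -- `g` may exchange the ends, but it multiplies both signs by the same factor.
    translate g {s} {t} {v} p q = Sign.*-cancelˡ-≡ (sgn g) s t (ball-o (pull p) (pull q))
      where
      pull : ∀ {s} → Toward (end s) (Ball (to g o) R) v →
        Toward (end (sgn g Sign.* s)) (Ball o R) (from g v)
      pull {s} p = toward-end-unmap g (ball-finite locFin (to g o) R) (λ _ → ball-map g)
        (subst (Toward (end s) _) (sym (strictlyInverseˡ g v)) p)

  module _ (R : ℕ) (ball-separates : ∀ x → Separates (Ball x R)) where

    private
      B : Vertex → Vertex → Set
      B x = Ball x R

      B-finite : ∀ x → Finite (B x)
      B-finite x = ball-finite locFin x R

    Side : Vertex → Sign → Vertex → Set
    Side x s v = Toward (end s) (B x) v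

    side-map : ∀ g {x s v} → Side x s v → Side (to g x) (sgn g Sign.* s) (to g v)
    side-map g {x} = toward-end-map g (B-finite (to g x)) (λ _ → ball-unmap g)

    side-unmap : ∀ g {x s v} → Side (to g x) s (to g v) → Side x (sgn g Sign.* s) v
    side-unmap g {x} = toward-end-unmap g (B-finite (to g x)) (λ _ → ball-map g)

    -- A relation rather than a function, so that properties can be proved by cases on the side of
    -- `v`; excluded middle then supplies the function `charge`.
    data Charge (x v : Vertex) : ℤ → Set where
      side    : ∀ s → Side x s v → Charge x v (s ◂ 1ℤ)
      neither : (∀ s → ¬ Side x s v) → Charge x v 0ℤ

    charge-exists : ∀ x v → ∃[ n ] Charge x v n
    charge-exists x v with em {P = ∃[ s ] Side x s v}
    ... | yes (s , p) = s ◂ 1ℤ , side s p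
    ... | no none     = 0ℤ , neither λ s p → none (s , p)

    charge : Vertex → Vertex → ℤ
    charge x v = proj₁ (charge-exists x v)

    charge-unique : ∀ {x v m n} → Charge x v m → Charge x v n → m ≡ n
    charge-unique {x} (side s p) (side t q) = cong (_◂ 1ℤ) (ball-separates x p q)
    charge-unique (side s p)   (neither ¬side) = contradiction p (¬side s)
    charge-unique (neither ¬side) (side s p)   = contradiction p (¬side s)
    charge-unique (neither _)  (neither _)  = refl

    charge≡ : ∀ {x v n} → Charge x v n → charge x v ≡ n
    charge≡ {x} {v} = charge-unique (proj₂ (charge-exists x v))

    charge-map : ∀ g x v → charge (to g x) (to g v) ≡ sgn g ◂ charge x v
    charge-map g x v = charge≡ (go (proj₂ (charge-exists x v)))
      where
      go : ∀ {n} → Charge x v n → Charge (to g x) (to g v) (sgn g ◂ n)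
      go (side s p)   = subst (Charge _ _) (◂-◂ (sgn g) s 1ℤ) (side _ (side-map g p))
      go (neither ¬side) = subst (Charge _ _) (sym (◂-zeroʳ (sgn g))) (neither λ s p → ¬side _ (side-unmap g p))

    charge-walk : ∀ x {v w} → Walk (∁ (B x)) v w → charge x v ≡ charge x w
    charge-walk x {v} {w} p = charge≡ (go (proj₂ (charge-exists x w)))
      where
      go : ∀ {n} → Charge x w n → Charge x v n
      go (side s q)   = side s (toward-walk (end s) p q)
      go (neither ¬side) = neither λ s q → ¬side s (toward-walk (end s) (reverseʷ p) q)

    -- The charges at two adjacent vertices differ only if the ball around `x` contains one of them,
    -- that is, if `x` lies in the finite ball around that vertex. A walk has finitely many edges.
    charge-differs-finitely : ∀ {v w} → Star _─_ v w → Finite (λ x → charge x v ≢ charge x w)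
    charge-differs-finitely ε = [] , λ x ne → contradiction refl ne
    charge-differs-finitely {v} (_◅_ {j = u} e p) =
      let xs , cover  = charge-differs-finitely p
          ys , cover′ = B-finite v
          zs , cover″ = B-finite u
      in ys ++ zs ++ xs , λ x ne → by-contradiction em λ x∉ → ne (trans
        (charge-walk x (step (λ b → x∉ (∈-++⁺ˡ (cover′ x (ball-sym b)))) e
          [ (λ b → x∉ (∈-++⁺ʳ ys (∈-++⁺ˡ (cover″ x (ball-sym b))))) ]))
        (by-contradiction em λ ne′ → x∉ (∈-++⁺ʳ ys (∈-++⁺ʳ zs (cover x ne′)))))

    private
      Apart : Vertex → Vertex → Set
      Apart x y = ∀ {z} → B x z → ¬ B y z

      apart-sym : ∀ {x y} → Apart x y → Apart y x
      apart-sym d b c = d c b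

      -- The ball around `y` is connected and misses the ball around `x`, so it lies in a single
      -- component of the complement of the latter.
      side-of-ball : ∀ {x y s u} → Apart x y → B y u → Side x s u → Side x s y
      side-of-ball {s = s} d b = toward-walk (end s) (mapʷ (λ c c′ → d c′ c) (ball-walk b))

      -- If y is not on side s of x, then x together with that side is connected
      -- and avoids the ball around y.
      side-dichotomy : ∀ {x y} s → Apart x y → Side x s y ⊎ Side y s x
      side-dichotomy {x} {y} s d with em {P = Side x s y}
      ... | yes p = inj₁ p
      ... | no ¬p =
        let i , t  = tail-exists (end s) (B x) (B-finite x)
            j , t′ = tail-exists (end s) (B y) (B-finite y)
            k      = i ⊔ j
            tₓ     = tail-mono {end s} {B x} (ℕ.m≤m⊔n i j) t
        in inj₂ (k , tail-mono {end s} {B y} (ℕ.m≤n⊔m i j) t′ ,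
             reverseʷ (walk (conn (Ray.vertex (end s) k) x) (inj₂ (k , tₓ , [ tₓ k ℕ.≤-refl ]))))
        where
        avoids : ∀ {u} → Side x s u → ¬ B y u
        avoids q b = ¬p (side-of-ball {s = s} d b q)

        walk : ∀ {u} → Star _─_ u x → B x u ⊎ Side x s u → Walk (∁ (B y)) u x
        walk ε       _        = [ d centre ]
        walk (e ◅ p) (inj₁ b) = reverseʷ (mapʷ (λ b → d b) (ball-walk b))
        walk (_◅_ {j = w} e p) (inj₂ q) with em {P = B x w}
        ... | yes b = step (avoids q) e (walk p (inj₁ b))
        ... | no ¬b = step (avoids q) e (walk p (inj₂
          (toward-walk (end s) (step ¬b (─-sym e) [ toward-avoids (end s) q ]) q)))

      -- The dichotomy is applied to the other end: its first alternative would put `y` on both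
      -- sides of `x`.
      opposite-side : ∀ {x y} s → Apart x y → Side x s y → Side y (Sign.opposite s) x
      opposite-side {x} s d p with side-dichotomy (Sign.opposite s) d
      ... | inj₁ q = contradiction (ball-separates x p q) (Sign.s≢opposite[s] s)
      ... | inj₂ q = q

      -- Were `y` on neither side of `x`, the dichotomy for both signs would put `x` on both sides
      -- of `y`.
      some-side : ∀ {x y} → Apart x y → ∃[ s ] Side x s y
      some-side {y = y} d with side-dichotomy Sign.+ d | side-dichotomy Sign.- d
      ... | inj₁ p | _      = Sign.+ , p
      ... | inj₂ _ | inj₁ q = Sign.- , q
      ... | inj₂ p | inj₂ q = contradiction (ball-separates y p q) (Sign.s≢opposite[s] Sign.+)

      -- Side `s` of `y` avoids the ball around `x`: if they met, the connected ball and with it `x`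
      -- would lie on side `s` of `y`, whereas `x` is on the opposite side. Hence the walk from `z`
      -- and the tail it reaches also avoid `B x`.
      side-nested : ∀ {x y z} s → Apart x y → Side x s y → Side y s z → Side x s z
      side-nested {x} {y} {z} s d p (i , t , q) =
        i , (λ j i≤j → avoids (j , tail-mono {end s} {B y} i≤j t , [ t j i≤j ])) ,
        mapʷ (λ r → avoids (i , t , r)) (walk-to-end q)
        where
        avoids : ∀ {u} → Side y s u → ¬ B x u
        avoids r b = Sign.s≢opposite[s] s (ball-separates y
          (side-of-ball {s = s} (apart-sym d) b r) (opposite-side s d p))

      bounds : ∀ {x v n} → Charge x v n → -1ℤ ℤ.≤ n × n ℤ.≤ 1ℤ
      bounds (side Sign.+ _) = ℤ.-≤+ , ℤ.≤-refl
      bounds (side Sign.- _) = ℤ.≤-refl , ℤ.-≤+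
      bounds (neither _)     = ℤ.-≤+ , ℤ.+≤+ z≤n

      charge-bounds : ∀ x v → -1ℤ ℤ.≤ charge x v × charge x v ℤ.≤ 1ℤ
      charge-bounds x v = bounds (proj₂ (charge-exists x v))

      -- If the balls around `x` and `v` are disjoint, `v` is on some side of `x`: on the negative
      -- side its charge is minimal, and on the positive side `side-nested` puts `w` there too. The
      -- other alternative is symmetric.
      charge-mono : ∀ {v w} → (∀ x → Apart x v ⊎ Apart x w) → Side v Sign.+ w → Side w Sign.- v →
        ∀ x → charge x v ℤ.≤ charge x w
      charge-mono {v} {w} far p q x with far x
      ... | inj₁ d with some-side d
      ...   | Sign.- , r = subst (ℤ._≤ charge x w) (sym (charge≡ (side Sign.- r))) (proj₁ (charge-bounds x w))
      ...   | Sign.+ , r = ℤ.≤-reflexive (trans (charge≡ (side Sign.+ r))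
        (sym (charge≡ (side Sign.+ (side-nested Sign.+ d r p)))))
      charge-mono {v} {w} far p q x | inj₂ d with some-side d
      ...   | Sign.+ , r = subst (charge x v ℤ.≤_) (sym (charge≡ (side Sign.+ r))) (proj₂ (charge-bounds x v))
      ...   | Sign.- , r = ℤ.≤-reflexive (trans (charge≡ (side Sign.- (side-nested Sign.- d r q)))
        (sym (charge≡ (side Sign.- r))))

      -- A ball around `x` that meets the balls around both `v` and `w` yields a walk from `v` to
      -- `w` through `x` and the two common vertices, in four stretches of length at most `R`.
      far⇒apart : ∀ {v w} → ¬ Ball v (R ℕ.+ R ℕ.+ (R ℕ.+ R)) w → ∀ x → Apart x v ⊎ Apart x w
      far⇒apart {v} {w} ¬near x with em {P = ∃[ z ] B x z × B v z}
      ... | no none = inj₁ λ b c → none (_ , b , c)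
      ... | yes (z , xz , vz) = inj₂ λ xz′ wz′ → ¬near
        (ball-trans (ball-trans vz (ball-sym xz)) (ball-trans xz′ (ball-sym wz′)))

    module _ (o : Vertex) where

      private
        difference-finite : ∀ v w → Finite (λ x → charge x v - charge x w ≢ 0ℤ)
        difference-finite v w =
          let xs , cover = charge-differs-finitely (conn v w)
          in xs , λ x ne → cover x (ne ∘ ℤ.i≡j⇒i-j≡0)

        height-exists : ∀ v → ∃[ n ] SumIs em (λ x → charge x v - charge x o) n
        height-exists v = let xs , cover = difference-finite v o in sum-exists em _ xs cover

      -- Measured from `o`, because the charges of `v` alone need not have finite support.
      height : Vertex → ℤ
      height v = proj₁ (height-exists v)

      -- The charges of the base point cancel, which leaves a sum that depends on `v` and `w` only.
      height-difference : ∀ v w → SumIs em (λ x → charge x v - charge x w) (height v - height w)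
      height-difference v w = sum-cong em (λ x → cancel (charge x v) (charge x w) (charge x o))
        (sum-+ em (proj₂ (height-exists v)) (sum-◂ em Sign.- (proj₂ (height-exists w))))
        where
        cancel : ∀ a b c → a - c + - (b - c) ≡ a - b
        cancel = solve-∀

      -- Substituting `to g x` for `x` permutes the terms of the sum, and each charge is multiplied
      -- by the sign of `g`.
      height-map : ∀ g v w → height (to g v) - height (to g w) ≡ sgn g ◂ (height v - height w)
      height-map g v w = sum-unique em (height-difference (to g v) (to g w))
        (sum-reindex em (to g) (from g) (strictlyInverseˡ g) (strictlyInverseʳ g)
          (sum-cong em (λ x → trans (◂-distrib-- (sgn g) (charge x v) (charge x w))
                                (sym (cong₂ _-_ (charge-map g x v) (charge-map g x w))))
            (sum-◂ em (sgn g) (height-difference v w))))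

      private
        height-≢ : ∀ {v w} → (∀ x → Apart x v ⊎ Apart x w) → Side v Sign.+ w → Side w Sign.- v →
          height v ≢ height w
        -- The summand at `x = v` is positive: `w` is on the positive side of `v`, while `v` lies in
        -- its own ball and so has charge 0.
        height-≢ {v} {w} far p q eq = ℤ.<-irrefl (sym (ℤ.i≡j⇒i-j≡0 (sym eq))) (sum-positive em
          (height-difference w v) (λ x → ℤ.i≤j⇒0≤j-i (charge-mono far p q x)) v
          (subst₂ (λ a b → 0ℤ ℤ.< a - b) (sym (charge≡ (side Sign.+ p)))
            (sym (charge≡ (neither λ s r → toward-avoids (end s) r centre))) (ℤ.+<+ (s≤s z≤n))))

      same-height⇒near : ∀ {v w} → height v ≡ height w → Ball v (R ℕ.+ R ℕ.+ (R ℕ.+ R)) w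
      same-height⇒near {v} {w} eq = by-contradiction em λ ¬near →
        let far = far⇒apart ¬near
            -- At `x = v` the first alternative fails, since a ball contains its centre.
            d   = [ (λ d → contradiction centre (d centre)) , id ]′ (far v)
        in case d far (some-side d)
        where
        case : Apart v w → (∀ x → Apart x v ⊎ Apart x w) → ∃[ s ] Side v s w → ⊥
        case d far (Sign.+ , p) = height-≢ far p (opposite-side Sign.+ d p) eq
        case d far (Sign.- , p) = height-≢ (λ x → [ inj₂ , inj₁ ]′ (far x))
          (opposite-side Sign.- d p) p (sym eq)

      same-height-finite : ∀ v → Finite (λ w → height v ≡ height w)
      same-height-finite v =
        let xs , cover = ball-finite locFin v (R ℕ.+ R ℕ.+ (R ℕ.+ R))
        in xs , λ w eq → cover w (same-height⇒near eq)

-- Levels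

module Differences {V : Set} (level : V → ℤ) where

  infix 6 _⊝_
  _⊝_ : V → V → ℤ
  v ⊝ w = level v - level w

  ⊝-self : ∀ v → v ⊝ v ≡ 0ℤ
  ⊝-self v = ℤ.+-inverseʳ (level v)

  ⊝-trans : ∀ u v w → (u ⊝ v) + (v ⊝ w) ≡ u ⊝ w
  ⊝-trans u v w = telescope (level u) (level v) (level w)
    where
    telescope : ∀ a b c → a - b + (b - c) ≡ a - c
    telescope = solve-∀

  ⊝-neg : ∀ v w → - (v ⊝ w) ≡ w ⊝ v
  ⊝-neg v w = swap (level v) (level w)
    where
    swap : ∀ a b → - (a - b) ≡ b - a
    swap = solve-∀

  ⊝⇒level : ∀ {v w n} → v ⊝ w ≡ n → level v ≡ n + level w
  ⊝⇒level {v} {w} refl = restore (level v) (level w)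
    where
    restore : ∀ a b → a ≡ a - b + b
    restore = solve-∀

  level⇒⊝ : ∀ {v w n} → level v ≡ n + level w → v ⊝ w ≡ n
  level⇒⊝ {v} {w} {n} eq = trans (cong (_- level w) eq) (cancel n (level w))
    where
    cancel : ∀ a b → a + b - b ≡ a
    cancel = solve-∀

-- `sgn` enters as a mere function. That it is a homomorphism is recovered from `⊝-map` in `sgn-∙`.
record Levelling (Γ : Digraph) (sgn : Automorphism Γ → Sign) : Set where
  open Digraph Γ
  open Automorphism using (to)
  field
    level : Vertex → ℤ
  open Differences level public
  field
    ⊝-map        : ∀ g v w → to g v ⊝ to g w ≡ sgn g ◂ (v ⊝ w)
    ⊝-arc        : ∀ {v w} → v ⟶ w → ∃[ s ] w ⊝ v ≡ s ◂ 1ℤ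
    level-finite : ∀ v → Finite (λ w → level w ≡ level v)

  Up Down : Vertex → Set
  Up   v = ∃[ w ] v ⟶ w × w ⊝ v ≡ 1ℤ
  Down v = ∃[ w ] v ⟶ w × w ⊝ v ≡ -1ℤ

  -- `Directed` leads to case (ii) and `Mixed` to case (i).
  Directed Mixed : Set
  Directed = ∀ {v w} → v ⟶ w → w ⊝ v ≡ 1ℤ
  Mixed    = ∀ v → Up v × Down v

module _ (em : ExcludedMiddle 0ℓ) (Γ : Digraph) (conn : Connected Γ)
  (vertexTrans : VertexTransitive Γ) (arcTrans : ArcTransitive Γ) (r : Ray Γ) where

  open Digraph Γ
  open Automorphism using (to; from; preserves; strictlyInverseˡ; strictlyInverseʳ)

  infinite : ∀ xs → ¬ (∀ v → v ∈ xs)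
  infinite xs all = finite (mk↣ (Ray.distinct r)) xs (λ i → all (Ray.vertex r i))

  some-arc : ∃[ v ] ∃[ w ] v ⟶ w
  some-arc with Ray.adjacent r 0
  ... | fwd a = _ , _ , a
  ... | bwd a = _ , _ , a

  out-arc : ∀ v → ∃[ w ] v ⟶ w
  out-arc v =
    let a , b , a⟶b = some-arc
        g , ga≡v    = vertexTrans a v
    in to g b , subst (_⟶ to g b) ga≡v (preserves g a⟶b)

  in-arc : ∀ v → ∃[ u ] u ⟶ v
  in-arc v =
    let a , b , a⟶b = some-arc
        g , gb≡v    = vertexTrans b v
    in to g a , subst (to g a ⟶_) gb≡v (preserves g a⟶b)

  module _ (sgn : Automorphism Γ → Sign) (height : Vertex → ℤ)
    (height-map : ∀ g v w → height (to g v) - height (to g w) ≡ sgn g ◂ (height v - height w))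
    (height-finite : ∀ v → Finite (λ w → height v ≡ height w)) where

    private
      module H = Differences height
      open H using () renaming (_⊝_ to _⊖_)

      a = proj₁ some-arc
      b = proj₁ (proj₂ some-arc)
      k = b ⊖ a

      -- An automorphism carries the fixed arc from `a` to `b` to the given one and multiplies its
      -- height difference `k` by a sign.
      arc-height : ∀ {v w} → v ⟶ w → ∃[ s ] w ⊖ v ≡ s ◂ k
      arc-height v⟶w with arcTrans (proj₂ (proj₂ some-arc)) v⟶w
      ... | g , refl , refl = sgn g , height-map g b a

      -- Otherwise the height would be constant by connectedness, although there are infinitely many
      -- vertices and each height occurs finitely often.
      k≢0 : k ≢ 0ℤ
      k≢0 k≡0 = let xs , cover = height-finite a in infinite xs λ v → cover v (constant (conn a v))
        where
        arc-constant : ∀ {v w} → v ⟶ w → height v ≡ height w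
        arc-constant v⟶w = let s , eq = arc-height v⟶w in sym (ℤ.i-j≡0⇒i≡j _ _
          (trans eq (trans (cong (s ◂_) k≡0) (◂-zeroʳ s))))
        constant : ∀ {v w} → Star _─_ v w → height v ≡ height w
        constant ε             = refl
        constant (fwd e ◅ p) = trans (arc-constant e) (constant p)
        constant (bwd e ◅ p) = trans (sym (arc-constant e)) (constant p)

      instance
        k-nonZero : ℤ.NonZero k
        k-nonZero = ℤ.≢-nonZero k≢0

      arc-multiple : ∀ {v w} → v ⟶ w → ∃[ s ] w ⊖ v ≡ (s ◂ 1ℤ) * k
      arc-multiple v⟶w = let s , eq = arc-height v⟶w in
        s , trans eq (trans (cong (s ◂_) (sym (ℤ.*-identityˡ k))) (◂-*-assoc s 1ℤ k))

      multiple : ∀ {v} → Star _─_ v a → ∃[ n ] v ⊖ a ≡ n * k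
      multiple ε = 0ℤ , H.⊝-self a
      multiple {v} (_◅_ {j = w} (fwd e) p) =
        let m , eq = multiple p
            s , eq′ = arc-multiple e
        in m - s ◂ 1ℤ , trans (sym (H.⊝-trans v w a)) (trans
             (cong₂ _+_ (trans (sym (H.⊝-neg w v)) (cong -_ eq′)) eq) (collect (s ◂ 1ℤ) m k))
        where
        collect : ∀ x y k → - (x * k) + y * k ≡ (y - x) * k
        collect = solve-∀
      multiple {v} (_◅_ {j = w} (bwd e) p) =
        let m , eq = multiple p
            s , eq′ = arc-multiple e
        in s ◂ 1ℤ + m , trans (sym (H.⊝-trans v w a))
             (trans (cong₂ _+_ eq′ eq) (sym (ℤ.*-distribʳ-+ k (s ◂ 1ℤ) m)))

      -- The quotient of `v ⊖ a` by `k`. As `k` is nonzero, it does not depend on the walk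
      -- `conn v a`.
      lev : Vertex → ℤ
      lev v = proj₁ (multiple (conn v a))

      lev-height : ∀ v w → (lev v - lev w) * k ≡ v ⊖ w
      lev-height v w = trans (distrib (lev v) (lev w) k) (trans
        (cong₂ _-_ (sym (proj₂ (multiple (conn v a)))) (sym (proj₂ (multiple (conn w a)))))
        (cancel (height v) (height w) (height a)))
        where
        distrib : ∀ x y k → (x - y) * k ≡ x * k - y * k
        distrib = solve-∀
        cancel : ∀ x y z → x - z - (y - z) ≡ x - y
        cancel = solve-∀

    normalise : Levelling Γ sgn
    normalise = record
      { level        = lev
      ; ⊝-map        = λ g v w → ℤ.*-cancelʳ-≡ _ _ k (begin
          (lev (to g v) - lev (to g w)) * k  ≡⟨ lev-height (to g v) (to g w) ⟩
          to g v ⊖ to g w                    ≡⟨ height-map g v w ⟩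
          sgn g ◂ (v ⊖ w)                    ≡⟨ cong (sgn g ◂_) (lev-height v w) ⟨
          sgn g ◂ ((lev v - lev w) * k)      ≡⟨ ◂-*-assoc (sgn g) (lev v - lev w) k ⟩
          (sgn g ◂ (lev v - lev w)) * k      ∎)
      ; ⊝-arc        = λ {v} {w} e → let s , eq = arc-multiple e in
          s , ℤ.*-cancelʳ-≡ _ _ k (trans (lev-height w v) eq)
      ; level-finite = λ v → let xs , cover = height-finite v in xs , λ w eq → cover w
          (sym (ℤ.i-j≡0⇒i≡j _ _ (trans (sym (lev-height w v)) (cong (_* k) (ℤ.i≡j⇒i-j≡0 eq)))))
      }
      where open ≡-Reasoning

  module _ {sgn : Automorphism Γ → Sign} (L : Levelling Γ sgn) where
    open Levelling L

    private
      up-map : ∀ g {v w s} → w ⊝ v ≡ s ◂ 1ℤ → to g w ⊝ to g v ≡ (sgn g Sign.* s) ◂ 1ℤ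
      up-map g {v} {w} {s} eq = trans (⊝-map g w v) (trans (cong (sgn g ◂_) eq) (sym (◂-◂ (sgn g) s 1ℤ)))

      -- An automorphism of negative sign exchanges `Up` and `Down`, so the conjunction of both is
      -- carried to every vertex.
      mixed-everywhere : ∀ {v} → Up v → Down v → Mixed
      mixed-everywhere {v} (u , v⟶u , up) (d , v⟶d , down) w with vertexTrans v w
      ... | g , refl with sgn g | up-map g {s = Sign.+} up | up-map g {s = Sign.-} down
      ...   | Sign.+ | up′ | down′ = (to g u , preserves g v⟶u , up′) , (to g d , preserves g v⟶d , down′)
      ...   | Sign.- | up′ | down′ = (to g d , preserves g v⟶d , down′) , (to g u , preserves g v⟶u , up′)

      module Unmixed (unmixed : ∀ v → ¬ (Up v × Down v)) where

        -- By `σ-arc` all arcs out of `v` have this sign, so the choice made by `out-arc` is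
        -- immaterial.
        σ : Vertex → Sign
        σ v = proj₁ (⊝-arc (proj₂ (out-arc v)))

        σ-arc : ∀ {v w} → v ⟶ w → w ⊝ v ≡ σ v ◂ 1ℤ
        σ-arc {v} {w} v⟶w =
          let u , v⟶u = out-arc v
              s , eq  = ⊝-arc v⟶w
              t , eq′ = ⊝-arc v⟶u
          in trans eq (cong (_◂ 1ℤ) (same s t v⟶u eq eq′))
          where
          same : ∀ s t {u} → v ⟶ u → w ⊝ v ≡ s ◂ 1ℤ → u ⊝ v ≡ t ◂ 1ℤ → s ≡ t
          same Sign.+ Sign.+ v⟶u eq eq′ = refl
          same Sign.+ Sign.- v⟶u eq eq′ = contradiction ((_ , v⟶w , eq) , (_ , v⟶u , eq′)) (unmixed v)
          same Sign.- Sign.+ v⟶u eq eq′ = contradiction ((_ , v⟶u , eq′) , (_ , v⟶w , eq)) (unmixed v)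
          same Sign.- Sign.- v⟶u eq eq′ = refl

        σ-map : ∀ g v → σ (to g v) ≡ sgn g Sign.* σ v
        σ-map g v = let w , v⟶w = out-arc v in ◂1-injective
          (trans (sym (σ-arc (preserves g v⟶w))) (up-map g {s = σ v} (σ-arc v⟶w)))

        -- Were σ to alternate along the arcs, there would be only two levels.
        σ-constant-on-arcs : ∀ {v w} → v ⟶ w → σ w ≡ σ v
        σ-constant-on-arcs {v} {w} v⟶w = by-contradiction em (absurd ∘ alternates ∘ ≢⇒≡opposite)
          where
          -- By arc-transitivity one alternating arc makes all arcs alternate.
          alternates : σ w ≡ Sign.opposite (σ v) → ∀ {x y} → x ⟶ y → σ y ≡ Sign.opposite (σ x)
          alternates opp x⟶y with arcTrans v⟶w x⟶y
          ... | g , refl , refl = trans (σ-map g w) (trans (cong (sgn g Sign.*_) opp)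
            (trans (*-opposite (sgn g) (σ v)) (cong Sign.opposite (sym (σ-map g v)))))

          module _ (alt : ∀ {x y} → x ⟶ y → σ y ≡ Sign.opposite (σ x)) where

            -- The sign is recorded along with the level because it decides whether an arc leads to
            -- the other of the two levels or away from both.
            TwoLevels : Vertex → Set
            TwoLevels x = level x ≡ level v × σ x ≡ σ v ⊎ level x ≡ level w × σ x ≡ Sign.opposite (σ v)

            level-w : level w ≡ σ v ◂ 1ℤ + level v
            level-w = ⊝⇒level (σ-arc v⟶w)

            below : ∀ {x y n} → y ⊝ x ≡ n → level x ≡ - n + level y
            below {x} {y} eq = ⊝⇒level (trans (sym (⊝-neg y x)) (cong -_ eq))

            level-v : level v ≡ Sign.opposite (σ v) ◂ 1ℤ + level w
            level-v = trans (below (σ-arc v⟶w)) (cong (_+ level w) (sym (opposite-◂ (σ v) 1ℤ)))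

            next : ∀ {x y} → x ⟶ y → TwoLevels x → TwoLevels y
            next {x} x⟶y (inj₁ (lx , sx)) = inj₂
              (trans (⊝⇒level (σ-arc x⟶y)) (trans (cong₂ (λ s n → s ◂ 1ℤ + n) sx lx) (sym level-w)) ,
               trans (alt x⟶y) (cong Sign.opposite sx))
            next {x} x⟶y (inj₂ (lx , sx)) = inj₁
              (trans (⊝⇒level (σ-arc x⟶y)) (trans (cong₂ (λ s n → s ◂ 1ℤ + n) sx lx) (sym level-v)) ,
               trans (alt x⟶y) (trans (cong Sign.opposite sx) (Sign.opposite-involutive (σ v))))

            previous : ∀ {x y} → x ⟶ y → TwoLevels y → TwoLevels x
            previous {x} {y} x⟶y (inj₁ (ly , sy)) = inj₂
              (trans (below (σ-arc x⟶y)) (trans (cong₂ _+_ (trans (sym (opposite-◂ (σ x) 1ℤ))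
                 (cong (_◂ 1ℤ) (trans (sym (alt x⟶y)) sy))) ly) (sym level-w)) ,
               Sign.opposite-injective (trans (sym (alt x⟶y)) (trans sy (sym (Sign.opposite-involutive (σ v))))))
            previous {x} {y} x⟶y (inj₂ (ly , sy)) = inj₁
              (trans (below (σ-arc x⟶y)) (trans (cong₂ _+_ (trans (sym (opposite-◂ (σ x) 1ℤ))
                 (cong (_◂ 1ℤ) (trans (sym (alt x⟶y)) sy))) ly) (sym level-v)) ,
               Sign.opposite-injective (trans (sym (alt x⟶y)) sy))

            spread : ∀ {x y} → Star _─_ x y → TwoLevels x → TwoLevels y
            spread ε           = id
            spread (fwd e ◅ p) = spread p ∘ next e
            spread (bwd e ◅ p) = spread p ∘ previous e

            absurd : ⊥
            absurd =
              let xs , cover  = level-finite v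
                  ys , cover′ = level-finite w
              in infinite (xs ++ ys) λ x →
                   [ ∈-++⁺ˡ ∘ cover x ∘ proj₁ , ∈-++⁺ʳ xs ∘ cover′ x ∘ proj₁ ]′
                     (spread (conn v x) (inj₁ (refl , refl)))

        σ-constant : ∀ {v w} → Star _─_ v w → σ v ≡ σ w
        σ-constant ε           = refl
        σ-constant (fwd e ◅ p) = trans (sym (σ-constant-on-arcs e)) (σ-constant p)
        σ-constant (bwd e ◅ p) = trans (σ-constant-on-arcs e) (σ-constant p)

        o : Vertex
        o = Ray.vertex r 0

        private
          oriented-⊝ : ∀ v w → σ o ◂ level v - σ o ◂ level w ≡ σ o ◂ (v ⊝ w)
          oriented-⊝ v w = sym (◂-distrib-- (σ o) (level v) (level w))

        arc-up : ∀ {v w} → v ⟶ w → σ o ◂ level w - σ o ◂ level v ≡ 1ℤ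
        arc-up {v} {w} v⟶w = trans (oriented-⊝ w v) (trans
          (cong (σ o ◂_) (trans (σ-arc v⟶w) (cong (_◂ 1ℤ) (σ-constant (conn v o)))))
          (◂-involutive (σ o) 1ℤ))

        -- Multiplying all levels by the constant sign `σ o` makes every arc rise, and it commutes
        -- with the action of `sgn g`.
        orient : Levelling Γ sgn
        orient = record
          { level        = λ v → σ o ◂ level v
          ; ⊝-map        = λ g v w → trans (oriented-⊝ (to g v) (to g w)) (trans
              (cong (σ o ◂_) (⊝-map g v w)) (trans (◂-comm (σ o) (sgn g) (v ⊝ w))
              (cong (sgn g ◂_) (sym (oriented-⊝ v w)))))
          ; ⊝-arc        = λ v⟶w → Sign.+ , arc-up v⟶w
          ; level-finite = λ v → let xs , cover = level-finite v in xs , λ w eq → cover w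
              (trans (sym (◂-involutive (σ o) (level w)))
                (trans (cong (σ o ◂_) eq) (◂-involutive (σ o) (level v))))
          }

    directed-or-mixed : Σ[ L ∈ Levelling Γ sgn ] (Levelling.Directed L ⊎ Levelling.Mixed L)
    directed-or-mixed with em {P = ∃[ v ] Up v × Down v}
    ... | yes (v , u , d) = L , inj₂ (mixed-everywhere u d)
    ... | no none = Unmixed.orient unmixed , inj₁ (Unmixed.arc-up unmixed)
      where
      unmixed : ∀ v → ¬ (Up v × Down v)
      unmixed v p = none (v , p)

-- The kernel of the action on levels

-- An isomorphism with the integers makes `G` commutative, but the reflections `(1ℤ , Sign.-)` and
-- `(0ℤ , Sign.-)` do not commute in `D∞`.
≅ℤ-≅D∞-exclusive : (G : Group 0ℓ 0ℓ) → G ≅ᴳ ℤ-group → ¬ G ≅ᴳ D∞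
≅ℤ-≅D∞-exclusive G (f , f-iso) (d , d-iso) = absurd (begin
  (1ℤ , Sign.-) D.∙ (0ℤ , Sign.-)  ≡⟨ cong₂ D._∙_ (d-pre (1ℤ , Sign.-)) (d-pre (0ℤ , Sign.-)) ⟨
  d x D.∙ d y                      ≡⟨ M.∙-homo x y ⟨
  d (x G.∙ y)                      ≡⟨ M.⟦⟧-cong commute ⟩
  d (y G.∙ x)                      ≡⟨ M.∙-homo y x ⟩
  d y D.∙ d x                      ≡⟨ cong₂ D._∙_ (d-pre (0ℤ , Sign.-)) (d-pre (1ℤ , Sign.-)) ⟩
  (0ℤ , Sign.-) D.∙ (1ℤ , Sign.-)  ∎)
  where
  module G = Group G
  module D = Group D∞
  module F = GroupMorphisms.IsGroupIsomorphism f-iso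
  module M = GroupMorphisms.IsGroupIsomorphism d-iso
  open ≡-Reasoning
  pre : ℤ × Sign → G.Carrier
  pre z = proj₁ (M.surjective z)
  d-pre : ∀ z → d (pre z) ≡ z
  d-pre z = proj₂ (M.surjective z) G.refl
  x = pre (1ℤ , Sign.-)
  y = pre (0ℤ , Sign.-)
  commute : (x G.∙ y) G.≈ (y G.∙ x)
  commute = F.injective (trans (F.∙-homo x y) (trans (ℤ.+-comm (f x) (f y)) (sym (F.∙-homo y x))))
  absurd : ¬ (1ℤ , Sign.+) ≡ (-1ℤ , Sign.+)
  absurd ()

caseI-caseII-exclusive : ∀ {Γ} (N : Subgroup (Aut Γ)) (normal : IsNormal N) →
  CaseI N normal → ¬ CaseII N normal
caseI-caseII-exclusive N normal (_ , ≅D∞) (_ , ≅ℤ) =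
  ≅ℤ-≅D∞-exclusive (quotientGroup N normal) ≅ℤ ≅D∞

suc-injective : ∀ {i j} → ℤ.suc i ≡ ℤ.suc j → i ≡ j
suc-injective {i} {j} eq = trans (sym (ℤ.pred-suc i)) (trans (cong ℤ.pred eq) (ℤ.pred-suc j))

module Kernel (em : ExcludedMiddle 0ℓ) (Γ : Digraph) (conn : Connected Γ)
  (vertexTrans : VertexTransitive Γ) (arcTrans : ArcTransitive Γ) (r : Ray Γ)
  (sgn : Automorphism Γ → Sign) (L : Levelling Γ sgn) where

  open Digraph Γ
  open Automorphism using (to; from; preserves; strictlyInverseˡ; strictlyInverseʳ)
  open Levelling L
  private
    module G = Group (Aut Γ)
    o = Ray.vertex r 0

  ⊝≡0⇒level : ∀ {v w} → v ⊝ w ≡ 0ℤ → level v ≡ level w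
  ⊝≡0⇒level = ℤ.i-j≡0⇒i≡j _ _

  level-image : ∀ g {v w} → level v ≡ level w → level (to g v) ≡ level (to g w)
  level-image g {v} {w} eq = ⊝≡0⇒level
    (trans (⊝-map g v w) (trans (cong (sgn g ◂_) (ℤ.i≡j⇒i-j≡0 eq)) (◂-zeroʳ (sgn g))))

  N : Subgroup (Aut Γ)
  N = record
    { Member    = λ g → ∀ v → level (to g v) ≡ level v
    ; resp      = λ g≈h g∈N v → trans (cong level (sym (g≈h v))) (g∈N v)
    ; ε-closed  = λ _ → refl
    ; ∙-closed  = λ {g} {h} g∈N h∈N v → trans (g∈N (to h v)) (h∈N v)
    ; ⁻¹-closed = λ {g} g∈N v →
        trans (sym (g∈N (from g v))) (cong level (strictlyInverseˡ g v))
    }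

  normal : IsNormal N
  normal g {n} n∈N v =
    trans (level-image g (n∈N (from g v))) (cong level (strictlyInverseˡ g v))

  sameOrbit⇒level : ∀ {v w} → SameOrbit N v w → level v ≡ level w
  sameOrbit⇒level {v} (g , g∈N , refl) = sym (g∈N v)

  -- An orbit is contained in a level set. Since `FiniteOrbits` asks for an exact list, the orbit is
  -- filtered out of that finite set by excluded middle.
  finite-orbits : FiniteOrbits N
  finite-orbits v =
    let xs , cover = level-finite v
    in filter orbit? xs , λ w → mk⇔
         (λ v∼w → ∈-filter⁺ orbit? (cover w (sym (sameOrbit⇒level v∼w))) v∼w)
         (λ m → proj₂ (∈-filter⁻ orbit? {xs = xs} m))
    where
    orbit? : ∀ w → Dec (SameOrbit N v w)
    orbit? w = em

  private
    _≈ᴺ_ = Group._≈_ (quotientGroup N normal)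

  ≈ᴺ⇒level : ∀ g h → g ≈ᴺ h → ∀ v → level (to g v) ≡ level (to h v)
  ≈ᴺ⇒level g h g≈h v = trans (level-image g (sym (g≈h v))) (cong level (strictlyInverseˡ g (to h v)))

  level⇒≈ᴺ : ∀ g h → (∀ v → level (to g v) ≡ level (to h v)) → g ≈ᴺ h
  level⇒≈ᴺ g h eq v = trans (level-image (g G.⁻¹) (sym (eq v))) (cong level (strictlyInverseʳ g v))

  -- Along an arc the level difference is 1 or -1, so a single arc determines the sign by which `g`
  -- acts.
  sgn-unique : ∀ g {v w s} → v ⟶ w → to g w ⊝ to g v ≡ s ◂ (w ⊝ v) → sgn g ≡ s
  sgn-unique g {v} {w} {s} v⟶w eq = let t , w⊝v = ⊝-arc v⟶w in
    Sign.*-cancelʳ-≡ t (sgn g) s (◂1-injective (begin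
      (sgn g Sign.* t) ◂ 1ℤ  ≡⟨ ◂-◂ (sgn g) t 1ℤ ⟩
      sgn g ◂ t ◂ 1ℤ         ≡⟨ cong (sgn g ◂_) w⊝v ⟨
      sgn g ◂ (w ⊝ v)        ≡⟨ ⊝-map g w v ⟨
      to g w ⊝ to g v        ≡⟨ eq ⟩
      s ◂ (w ⊝ v)            ≡⟨ cong (s ◂_) w⊝v ⟩
      s ◂ t ◂ 1ℤ             ≡⟨ ◂-◂ s t 1ℤ ⟨
      (s Sign.* t) ◂ 1ℤ      ∎))
    where open ≡-Reasoning

  private
    arc : ∃[ a ] ∃[ b ] a ⟶ b
    arc = some-arc em Γ conn vertexTrans arcTrans r

  sgn-unique′ : ∀ g {s} → (∀ v w → to g w ⊝ to g v ≡ s ◂ (w ⊝ v)) → sgn g ≡ s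
  sgn-unique′ g eq = let a , b , a⟶b = arc in sgn-unique g a⟶b (eq a b)

  sgn-∙ : ∀ g h → sgn (g G.∙ h) ≡ sgn g Sign.* sgn h
  sgn-∙ g h = sgn-unique′ (g G.∙ h) λ v w → trans (⊝-map g (to h w) (to h v))
    (trans (cong (sgn g ◂_) (⊝-map h w v)) (sym (◂-◂ (sgn g) (sgn h) (w ⊝ v))))

  sgn-ε : sgn G.ε ≡ Sign.+
  sgn-ε = sgn-unique′ G.ε λ _ _ → refl

  from-⊝ : ∀ g v w → from g v ⊝ from g w ≡ sgn g ◂ (v ⊝ w)
  from-⊝ g v w = begin
    from g v ⊝ from g w                            ≡⟨ ◂-involutive (sgn g) _ ⟨
    sgn g ◂ sgn g ◂ (from g v ⊝ from g w)          ≡⟨ cong (sgn g ◂_) (⊝-map g (from g v) (from g w)) ⟨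
    sgn g ◂ (to g (from g v) ⊝ to g (from g w))    ≡⟨ cong (sgn g ◂_) (cong₂ _⊝_ (strictlyInverseˡ g v) (strictlyInverseˡ g w)) ⟩
    sgn g ◂ (v ⊝ w)                                ∎
    where open ≡-Reasoning

  sgn-⁻¹ : ∀ g → sgn (g G.⁻¹) ≡ sgn g
  sgn-⁻¹ g = sgn-unique′ (g G.⁻¹) λ v w → from-⊝ g w v

  -- On levels measured from `o`, `g` acts as the affine map taking `n` to `sgn g ◂ n + shift g`.
  -- The pair of `shift g` and `sgn g` is the corresponding element of `D∞`.
  shift : Automorphism Γ → ℤ
  shift g = to g o ⊝ o

  level-to : ∀ g v → to g v ⊝ o ≡ sgn g ◂ (v ⊝ o) + shift g
  level-to g v = trans (sym (⊝-trans (to g v) (to g o) o)) (cong (_+ shift g) (⊝-map g v o))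

  shift-∙ : ∀ g h → shift (g G.∙ h) ≡ shift g + sgn g ◂ shift h
  shift-∙ g h = trans (level-to g (to h o)) (ℤ.+-comm (sgn g ◂ shift h) (shift g))

  shift-⁻¹ : ∀ g → shift (g G.⁻¹) ≡ sgn g ◂ - shift g
  shift-⁻¹ g = begin
    from g o ⊝ o                  ≡⟨ cong (from g o ⊝_) (strictlyInverseʳ g o) ⟨
    from g o ⊝ from g (to g o)    ≡⟨ from-⊝ g o (to g o) ⟩
    sgn g ◂ (o ⊝ to g o)          ≡⟨ cong (sgn g ◂_) (⊝-neg (to g o) o) ⟨
    sgn g ◂ - shift g             ∎
    where open ≡-Reasoning

  ⊝o-injective : ∀ {v w} → v ⊝ o ≡ w ⊝ o → level v ≡ level w
  ⊝o-injective eq = trans (⊝⇒level eq) (sym (⊝⇒level refl))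

  ≈ᴺ⇒shift : ∀ g h → g ≈ᴺ h → shift g ≡ shift h
  ≈ᴺ⇒shift g h g≈h = cong (_- level o) (≈ᴺ⇒level g h g≈h o)

  ≈ᴺ⇒sgn : ∀ g h → g ≈ᴺ h → sgn g ≡ sgn h
  ≈ᴺ⇒sgn g h g≈h = sgn-unique′ g λ v w →
    trans (cong₂ _-_ (≈ᴺ⇒level g h g≈h w) (≈ᴺ⇒level g h g≈h v)) (⊝-map h w v)

  shift,sgn⇒≈ᴺ : ∀ g h → shift g ≡ shift h → sgn g ≡ sgn h → g ≈ᴺ h
  shift,sgn⇒≈ᴺ g h eq eq′ = level⇒≈ᴺ g h λ v → ⊝o-injective (trans (level-to g v)
    (trans (cong₂ (λ s n → s ◂ (v ⊝ o) + n) eq′ eq) (sym (level-to h v))))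

  ⊝⇒suc : ∀ {v w} → w ⊝ v ≡ 1ℤ → level w ≡ ℤ.suc (level v)
  ⊝⇒suc = ⊝⇒level

  ⊝-1⇒suc : ∀ {v w} → w ⊝ v ≡ -1ℤ → level v ≡ ℤ.suc (level w)
  ⊝-1⇒suc {v} {w} eq = ⊝⇒level (trans (sym (⊝-neg w v)) (cong -_ eq))

  level-surjective : (∀ v → ∃[ w ] w ⊝ v ≡ 1ℤ) → (∀ v → ∃[ w ] w ⊝ v ≡ -1ℤ) →
    ∀ n → ∃[ v ] level v ≡ n
  level-surjective up down n =
    let v , eq = reach (n - level o) in v , trans (⊝⇒level eq) (restore n (level o))
    where
    restore : ∀ a b → a - b + b ≡ a
    restore = solve-∀
    climb : ∀ {m k} → (∀ v → ∃[ w ] w ⊝ v ≡ k) → ∃[ v ] v ⊝ o ≡ m → ∃[ v ] v ⊝ o ≡ k + m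
    climb next (v , eq) = let w , eq′ = next v in
      w , trans (sym (⊝-trans w v o)) (cong₂ _+_ eq′ eq)
    reach : ∀ n → ∃[ v ] v ⊝ o ≡ n
    reach (ℤ.+ zero)       = o , ⊝-self o
    reach (ℤ.+ suc n)      = climb up (reach (ℤ.+ n))
    reach (ℤ.-[1+ zero ])  = climb down (reach (ℤ.+ 0))
    reach (ℤ.-[1+ suc n ]) = climb down (reach ℤ.-[1+ n ])

  shift-surjective : (∀ n → ∃[ v ] level v ≡ n) → ∀ n → ∃[ g ] shift g ≡ n
  shift-surjective surj n =
    let v , eq = surj (n + level o)
        g , go≡v = vertexTrans o v
    in g , level⇒⊝ (trans (cong level go≡v) eq)

  -- An automorphism of positive sign preserves level differences, so preserving the level of one
  -- vertex makes it preserve all levels.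
  sgn+⇒sameOrbit : ∀ g {v} → sgn g ≡ Sign.+ → level v ≡ level (to g v) → SameOrbit N v (to g v)
  sgn+⇒sameOrbit g {v} eq level≡ = g , (λ u → trans (⊝⇒level
    (trans (⊝-map g u v) (cong (_◂ (u ⊝ v)) eq)))
    (trans (cong ((u ⊝ v) +_) (sym level≡)) (sym (⊝⇒level refl)))) , refl

  module DirectedCase (directed : Directed) where

    sgn≡+ : ∀ g → sgn g ≡ Sign.+
    sgn≡+ g = let a , b , a⟶b = arc in
      sgn-unique g a⟶b (trans (directed (preserves g a⟶b)) (sym (directed a⟶b)))

    level⇒sameOrbit : ∀ {v w} → level v ≡ level w → SameOrbit N v w
    level⇒sameOrbit {v} {w} eq with vertexTrans v w
    ... | g , refl = sgn+⇒sameOrbit g (sgn≡+ g) eq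

    surjective : ∀ n → ∃[ v ] level v ≡ n
    surjective = level-surjective
      (λ v → let w , v⟶w = out-arc em Γ conn vertexTrans arcTrans r v in w , directed v⟶w)
      (λ v → let u , u⟶v = in-arc em Γ conn vertexTrans arcTrans r v in
        u , trans (sym (⊝-neg v u)) (cong -_ (directed u⟶v)))

    caseII : CaseII N normal
    caseII =
      (level , record
        { isOrderMonomorphism = record
          { isOrderHomomorphism = record
            { cong = sameOrbit⇒level
            ; mono = λ (v , w , a∼v , b∼w , v⟶w) → trans (sameOrbit⇒level b∼w)
                (trans (⊝⇒suc (directed v⟶w)) (cong ℤ.suc (sym (sameOrbit⇒level a∼v))))
            }
          ; injective = level⇒sameOrbit
          -- Any arc out of `a` serves: it rises by 1, so its head is on the level of `b` and hence
          -- in the same orbit.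
          ; cancel    = λ {a} {b} eq →
              let w , a⟶w = out-arc em Γ conn vertexTrans arcTrans r a
              in a , w , level⇒sameOrbit refl ,
                 level⇒sameOrbit (trans eq (sym (⊝⇒suc (directed a⟶w)))) , a⟶w
          }
        ; surjective = λ n → let v , eq = surjective n in v , λ z∼v → trans (sameOrbit⇒level z∼v) eq
        })
      , (shift , record
        { isGroupMonomorphism = record
          { isGroupHomomorphism = record
            { isMonoidHomomorphism = record
              { isMagmaHomomorphism = record
                { isRelHomomorphism = record { cong = λ {g} {h} → ≈ᴺ⇒shift g h }
                ; homo = λ g h → trans (shift-∙ g h) (cong (λ s → shift g + s ◂ shift h) (sgn≡+ g))
                }
              ; ε-homo = ⊝-self o
              }
            ; ⁻¹-homo = λ g → trans (shift-⁻¹ g) (cong (_◂ - shift g) (sgn≡+ g))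
            }
          ; injective = λ {g} {h} eq → shift,sgn⇒≈ᴺ g h eq (trans (sgn≡+ g) (sym (sgn≡+ h)))
          }
        ; surjective = λ n → let g , eq = shift-surjective surjective n in
            g , λ {h} h≈g → trans (≈ᴺ⇒shift h g h≈g) eq
        })

    propertyZ : PropertyZ Γ
    propertyZ = level , (λ v⟶w → ⊝⇒suc (directed v⟶w)) ,
      λ n → let v , eq = surjective n in v , λ { refl → eq }

  module MixedCase (mixed : Mixed) where

    -- Arc-transitivity takes a rising arc at `v` to a falling one, which fixes `v` and reverses the
    -- levels.
    reflection : ∀ v → ∃[ g ] to g v ≡ v × sgn g ≡ Sign.-
    reflection v =
      let (u , v⟶u , up) , (d , v⟶d , down) = mixed v
          g , gv≡v , gu≡d = arcTrans v⟶u v⟶d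
      in g , gv≡v , sgn-unique g v⟶u (trans (cong₂ _⊝_ gu≡d gv≡v) (trans down (cong -_ (sym up))))

    level⇒sameOrbit : ∀ {v w} → level v ≡ level w → SameOrbit N v w
    level⇒sameOrbit {v} {w} eq = go (vertexTrans v w)
      where
      go : ∃[ g ] to g v ≡ w → SameOrbit N v w
      go (g , gv≡w) with sgn g in sgn≡
      ... | Sign.+ = subst (SameOrbit N v) gv≡w
        (sgn+⇒sameOrbit g sgn≡ (trans eq (cong level (sym gv≡w))))
      -- A reflection fixing `v` is applied first; this makes the sign positive without moving the
      -- image of `v`.
      ... | Sign.- =
        let h , hv≡v , sgnh = reflection v
            ghv≡w = trans (cong (to g) hv≡v) gv≡w
        in subst (SameOrbit N v) ghv≡w (sgn+⇒sameOrbit (g G.∙ h)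
             (trans (sgn-∙ g h) (cong₂ Sign._*_ sgn≡ sgnh)) (trans eq (cong level (sym ghv≡w))))

    surjective : ∀ n → ∃[ v ] level v ≡ n
    surjective = level-surjective
      (λ v → let (w , _ , eq) , _ = mixed v in w , eq)
      (λ v → let _ , (w , _ , eq) = mixed v in w , eq)

    caseI : CaseI N normal
    caseI =
      (level , record
        { isOrderMonomorphism = record
          { isOrderHomomorphism = record
            { cong = sameOrbit⇒level
            ; mono = λ (v , w , a∼v , b∼w , v⟶w) →
                subst₂ (λ i j → j ≡ ℤ.suc i ⊎ i ≡ ℤ.suc j)
                  (sym (sameOrbit⇒level a∼v)) (sym (sameOrbit⇒level b∼w)) (adjacent (⊝-arc v⟶w))
            }
          ; injective = level⇒sameOrbit
          ; cancel    = λ {a} {b} → λ where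
              (inj₁ eq) → let (w , a⟶w , up) , _ = mixed a in
                a , w , level⇒sameOrbit refl , level⇒sameOrbit (trans eq (sym (⊝⇒suc up))) , a⟶w
              (inj₂ eq) → let _ , (w , a⟶w , down) = mixed a in
                a , w , level⇒sameOrbit refl ,
                level⇒sameOrbit (suc-injective (trans (sym eq) (⊝-1⇒suc down))) , a⟶w
          }
        ; surjective = λ n → let v , eq = surjective n in v , λ z∼v → trans (sameOrbit⇒level z∼v) eq
        })
      , ((λ g → shift g , sgn g) , record
        { isGroupMonomorphism = record
          { isGroupHomomorphism = record
            { isMonoidHomomorphism = record
              { isMagmaHomomorphism = record
                { isRelHomomorphism = record
                  { cong = λ {g} {h} g≈h → cong₂ _,_ (≈ᴺ⇒shift g h g≈h) (≈ᴺ⇒sgn g h g≈h) }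
                ; homo = λ g h → cong₂ _,_ (shift-∙ g h) (sgn-∙ g h)
                }
              ; ε-homo = cong₂ _,_ (⊝-self o) sgn-ε
              }
            ; ⁻¹-homo = λ g → cong₂ _,_ (shift-⁻¹ g) (sgn-⁻¹ g)
            }
          ; injective = λ {g} {h} eq → shift,sgn⇒≈ᴺ g h (cong proj₁ eq) (cong proj₂ eq)
          }
        ; surjective = λ (n , s) → let g , eq , eq′ = realise n s in
            g , λ {h} h≈g → cong₂ _,_ (trans (≈ᴺ⇒shift h g h≈g) eq) (trans (≈ᴺ⇒sgn h g h≈g) eq′)
        })
      where
      adjacent : ∀ {v w} → ∃[ s ] w ⊝ v ≡ s ◂ 1ℤ → level w ≡ ℤ.suc (level v) ⊎ level v ≡ ℤ.suc (level w)
      adjacent (Sign.+ , eq) = inj₁ (⊝⇒suc eq)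
      adjacent (Sign.- , eq) = inj₂ (⊝-1⇒suc eq)

      realise : ∀ n s → ∃[ g ] shift g ≡ n × sgn g ≡ s
      realise n s with shift-surjective surjective n
      ... | g , eq with sgn g Sign.≟ s
      ...   | yes sgn≡ = g , eq , sgn≡
      ...   | no  sgn≢ =
        -- Precomposing with a reflection that fixes `o` flips the sign and keeps the shift.
        let h , ho≡o , sgnh = reflection o
        in g G.∙ h , trans (cong (λ v → to g v ⊝ o) ho≡o) eq ,
           trans (sgn-∙ g h) (trans (cong₂ Sign._*_ (≢⇒≡opposite sgn≢) sgnh) (flip s))
        where
        flip : ∀ s → Sign.opposite s Sign.* Sign.- ≡ s
        flip Sign.+ = refl
        flip Sign.- = refl

    -- A zigzag between two levels would be mapped injectively into ℤ.
    ¬propertyZ : ¬ PropertyZ Γ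
    ¬propertyZ (f , hom , _) =
      let xs , cover = level-finite o
      in finite (mk↣ {to = zigzag} (λ {i} {j} → injective i j)) xs (λ i → cover _ (zigzag-level i))
      where
      step : ∀ v → ∃[ w ] level w ≡ level v × f v ℤ.< f w
      step v =
        let (u , v⟶u , up) , _   = mixed v
            _ , (w , u⟶w , down) = mixed u
        in w , suc-injective (trans (sym (⊝-1⇒suc down)) (⊝⇒suc up)) ,
           ℤ.<-trans (ℤ.suc[i]≤j⇒i<j (ℤ.≤-reflexive (sym (hom v⟶u))))
             (ℤ.suc[i]≤j⇒i<j (ℤ.≤-reflexive (sym (hom u⟶w))))

      zigzag : ℕ → Vertex
      zigzag zero    = o
      zigzag (suc n) = proj₁ (step (zigzag n))

      zigzag-level : ∀ n → level (zigzag n) ≡ level o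
      zigzag-level zero    = refl
      zigzag-level (suc n) = trans (proj₁ (proj₂ (step (zigzag n)))) (zigzag-level n)

      increasing : ∀ {i j} → suc i ≤′ j → f (zigzag i) ℤ.< f (zigzag j)
      increasing {i} ≤′-refl     = proj₂ (proj₂ (step (zigzag i)))
      increasing (≤′-step {n} p) = ℤ.<-trans (increasing p) (proj₂ (proj₂ (step (zigzag n))))

      injective : ∀ i j → zigzag i ≡ zigzag j → i ≡ j
      injective i j eq with ℕ.<-cmp i j
      ... | tri< lt _ _  = contradiction (increasing (ℕ.≤⇒≤′ lt)) (ℤ.<-irrefl (cong f eq))
      ... | tri≈ _ i≡j _ = i≡j
      ... | tri> _ _ gt  = contradiction (increasing (ℕ.≤⇒≤′ gt)) (ℤ.<-irrefl (cong f (sym eq)))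

    -- From `o` there are 2-arcs that rise and then fall, and 2-arcs that rise twice. Their ends
    -- differ in level by 0 and by 2, and automorphisms preserve this difference up to sign.
    ¬twoArcTransitive : ¬ TwoArcTransitive Γ
    ¬twoArcTransitive twoArc =
      let (u , o⟶u , up)   , _   = mixed o
          (t , u⟶t , up′)  , (d , u⟶d , down) = mixed u
          g , go≡o , gu≡u , gd≡t = twoArc o⟶u u⟶d o⟶u u⟶t
          t⊝o≡2 = trans (sym (⊝-trans t u o)) (cong₂ _+_ up′ up)
          d⊝o≡0 = trans (sym (⊝-trans d u o)) (cong₂ _+_ down up)
      in absurd (begin
           ℤ.+ 2            ≡⟨ t⊝o≡2 ⟨
           t ⊝ o            ≡⟨ cong₂ _⊝_ gd≡t go≡o ⟨
           to g d ⊝ to g o  ≡⟨ ⊝-map g d o ⟩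
           sgn g ◂ (d ⊝ o)  ≡⟨ cong (sgn g ◂_) d⊝o≡0 ⟩
           sgn g ◂ 0ℤ       ≡⟨ ◂-zeroʳ (sgn g) ⟩
           0ℤ               ∎)
      where
      open ≡-Reasoning
      absurd : ¬ ℤ.+ 2 ≡ 0ℤ
      absurd ()

-- The action on the ends, and the theorem

module _ (em : ExcludedMiddle 0ℓ) (Γ : Digraph) (r₁ r₂ : Ray Γ)
  (r₁≁r₂ : ¬ (r₁ ∼ r₂)) (r₁-or-r₂ : ∀ (r : Ray Γ) → r ∼ r₁ ⊎ r ∼ r₂) where

  open Rays em Γ
  open Ends em Γ r₁ r₂ r₁≁r₂ r₁-or-r₂

  sgn-action : ∀ g {s} → sgn g ≡ s → ∀ {r t} → r ≋ end t → g · r ≋ end (s Sign.* t)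
  sgn-action g refl {t = t} r≋ = ≋-trans (≋-map g r≋) (sgn-end g t)

  sgn+⇒trivialOnEnds : (∀ g → sgn g ≡ Sign.+) → TrivialOnEnds Γ
  sgn+⇒trivialOnEnds sgn≡+ g r = let t , r≋ = end-of r in
    ≋⇒∼ (≋-trans (sgn-action g (sgn≡+ g) r≋) (≋-sym r≋))

  sgn-⇒transitiveOnEnds : ∃[ g ] sgn g ≡ Sign.- → TransitiveOnEnds Γ
  sgn-⇒transitiveOnEnds (g , sgn≡-) r s = go (end-of r) (end-of s)
    where
    e : Automorphism Γ
    e = Group.ε (Aut Γ)
    -- `e · r` has the vertices of `r` but other proofs of adjacency, so the equivalence is
    -- repackaged through `meet`, where only the vertices matter.
    identity : ∀ {t} → r ≋ end t → e · r ≋ end t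
    identity = ≋-trans (record { meet = _≋_.meet (≋-refl {r}) })
    go : ∃[ t ] r ≋ end t → ∃[ u ] s ≋ end u → ∃[ g ] g · r ∼ s
    go (Sign.+ , p) (Sign.+ , q) = e , ≋⇒∼ (≋-trans (identity p) (≋-sym q))
    go (Sign.+ , p) (Sign.- , q) = g , ≋⇒∼ (≋-trans (sgn-action g sgn≡- p) (≋-sym q))
    go (Sign.- , p) (Sign.+ , q) = g , ≋⇒∼ (≋-trans (sgn-action g sgn≡- p) (≋-sym q))
    go (Sign.- , p) (Sign.- , q) = e , ≋⇒∼ (≋-trans (identity p) (≋-sym q))

  module _ (conn : Connected Γ) (vertexTrans : VertexTransitive Γ) (arcTrans : ArcTransitive Γ) where

    levelling : Levelling Γ sgn
    levelling =
      let locFin       = locally-finite conn vertexTrans arcTrans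
          open Height em Γ r₁ r₂ r₁≁r₂ r₁-or-r₂ conn locFin
          R , separates = separating-radius vertexTrans
          o            = Ray.vertex r₁ 0
      in normalise em Γ conn vertexTrans arcTrans r₁ sgn (height R separates o)
           (height-map R separates o) (same-height-finite R separates o)

lemma7 : ExcludedMiddle 0ℓ →
    (Γ : Digraph) →
    VertexTransitive Γ → ArcTransitive Γ → TwoEnded Γ →
    Σ[ N ∈ Subgroup (Aut Γ) ] Σ[ normal ∈ IsNormal N ]
    FiniteOrbits N ×
    (CaseI N normal ⊎ CaseII N normal) ×
    (CaseII N normal → PropertyZ Γ) ×
    (CaseI N normal → ¬ PropertyZ Γ) ×
    (TwoArcTransitive Γ → CaseII N normal) ×
    (CaseI N normal → TransitiveOnEnds Γ) ×
    (CaseII N normal → TrivialOnEnds Γ)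
lemma7 em Γ vertexTrans arcTrans (conn , r₁ , r₂ , r₁≁r₂ , r₁-or-r₂) =
  conclude (directed-or-mixed em Γ conn vertexTrans arcTrans r₁
    (levelling em Γ r₁ r₂ r₁≁r₂ r₁-or-r₂ conn vertexTrans arcTrans))
  where
  open Ends em Γ r₁ r₂ r₁≁r₂ r₁-or-r₂ using (sgn)

  conclude : Σ[ L ∈ Levelling Γ sgn ] (Levelling.Directed L ⊎ Levelling.Mixed L) → _
  conclude (L , inj₁ directed) =
    N , normal , finite-orbits , inj₂ caseII , const propertyZ ,
    -- Statements about the other case hold vacuously, since the quotient group cannot be isomorphic
    -- to both `ℤ-group` and `D∞`.
    (λ I → contradiction caseII (caseI-caseII-exclusive N normal I)) , const caseII ,
    (λ I → contradiction caseII (caseI-caseII-exclusive N normal I)) ,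
    const (sgn+⇒trivialOnEnds em Γ r₁ r₂ r₁≁r₂ r₁-or-r₂ sgn≡+)
    where
    open Kernel em Γ conn vertexTrans arcTrans r₁ sgn L
    open DirectedCase directed
  conclude (L , inj₂ mixed) =
    N , normal , finite-orbits , inj₁ caseI ,
    (λ II → contradiction II (caseI-caseII-exclusive N normal caseI)) ,
    const ¬propertyZ , (λ twoArc → contradiction twoArc ¬twoArcTransitive) ,
    const (sgn-⇒transitiveOnEnds em Γ r₁ r₂ r₁≁r₂ r₁-or-r₂
      (let g , _ , sgn≡- = reflection (Ray.vertex r₁ 0) in g , sgn≡-)) ,
    (λ II → contradiction II (caseI-caseII-exclusive N normal caseI))
    where
    open Kernel em Γ conn vertexTrans arcTrans r₁ sgn L
    open MixedCase mixed
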